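{- Let $G=(V,E)$ be a finite simple undirected graph and let $k>0$. Then for all positive integers $t_1,\dots,t_k$, \begin{align*}\chi_G^k(t_1,\dots,t_k)&=(t_1t_2\cdots t_k)^{c(G)}\,\chi^k_{M(G)}(t_k,t_{k-1},\dots,t_1)\\&=(-1)^{k\,\mathrm{rk}(G)}(t_1\cdots t_k)^{c(G)}\,T^k_{M(G)}(1-t_k,1-t_{k-1},\dots,1-t_1;\,0,\dots,0).\end{align*}
   Context: Graph notation: for $A\subseteq E$, $c(A)$ is the number of connected components of $(V,A)$, $c(G)=c(E)$, $\mathrm{rk}(A)=|V|-c(A)$, $\mathrm{rk}(G)=\mathrm{rk}(E)$, and $M(G)=(E,\mathrm{rk})$ is the graphic matroid. Coupled multicolorings: let $\mathcal{C}_1,\dots,\mathcal{C}_k$ be color sets. A $k$-multicoloring is a $k$-tuple $(f_1,\dots,f_k)$ of functions $f_i:V\to\mathcal{C}_i$. For $k>1$ it is a coupled $k$-multicoloring if for every edge $\{a,b\}\in E$: (i) for every even index $2m$ with $2\le 2m\le k$: if $f_i(a)=f_i(b)$ for all odd $i$ with $1\le i\le 2m-1$, then $f_{2m}(a)=f_{2m}(b)$; and (ii) if $k$ is odd, additionally: if $f_i(a)=f_i(b)$ for all odd $i$ with $1\le i\le k-2$, then $f_k(a)\ne f_k(b)$. For $k=1$, a coupled $1$-multicoloring is a proper vertex coloring ($f_1(a)\neq f_1(b)$ for every edge $\{a,b\}$). For positive integers $t_1,\dots,t_k$, $\chi_G^k(t_1,\dots,t_k)$ is the number of coupled $k$-multicolorings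 of $G$ with color sets of sizes $|\mathcal{C}_i|=t_i$. Matroid polynomials: for a matroid $M=(\mathcal{A},\mathrm{rk})$ with $\mathrm{rk}(M)=\mathrm{rk}(\mathcal{A})$, let $\mathcal{C}^k_{\mathcal{A}}=\{(A_1,\dots,A_k)\mid A_1\subseteq\cdots\subseteq A_k\subseteq\mathcal{A}\}$ (inclusions need not be strict). Then $\chi_M^k(t_1,\dots,t_k)=\sum_{(A_i)\in\mathcal{C}^k_{\mathcal{A}}}\prod_{i=1}^k(-1)^{|A_i|}t_i^{\mathrm{rk}(M)-\mathrm{rk}(A_i)}$ and $T^k_M(x_1,\dots,x_k;y_1,\dots,y_k)=\sum_{(A_i)\in\mathcal{C}^k_{\mathcal{A}}}\prod_{i=1}^k(x_i-1)^{\mathrm{rk}(M)-\mathrm{rk}(A_i)}(y_i-1)^{|A_i|-\mathrm{rk}(A_i)}$. -}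

module Defs where

open import Data.Fin.Base using (Fin; zero; suc; toℕ; finToFun)
import Data.Fin.Properties as Fin
open import Data.Fin.Subset using (Subset; inside; outside; _∈_; _⊆_; _∪_; _∩_; ∣_∣; ⊤)
open import Data.Fin.Subset.Properties using (_∈?_; _⊆?_; x∈p∪q⁻; p∩q⊆p; p∩q⊆q)
open import Data.Integer.Base using (ℤ; 0ℤ; 1ℤ; -1ℤ; _-_) renaming (_+_ to _+ℤ_; _*_ to _*ℤ_; _^_ to _^ℤ_)
import Data.Integer.Properties as ℤ
open import Data.List.Base as List using (List; []; _∷_; _++_; length; filter; deduplicate; allFin; cartesianProductWith)
import Data.List.Membership.Propositional as List∈
open import Data.List.Membership.Propositional.Properties using (∈-allFin; ∈-++⁻; ∈-++⁺ˡ; ∈-++⁺ʳ)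
open import Data.List.Properties using (length-removeAt′; length-tabulate)
open import Data.List.Relation.Unary.All as All using (All; []; _∷_)
open import Data.List.Relation.Unary.AllPairs using (AllPairs; []; _∷_)
open import Data.List.Relation.Unary.Any as Any using (Any; here; there; _─_)
open import Data.List.Relation.Unary.Unique.DecSetoid.Properties using (deduplicate-!)
import Data.List.Relation.Unary.Any.Properties as Any
open import Data.Nat.Base using (ℕ; zero; suc; _+_; _∸_; _≤_; z≤n; s≤s)
open import Data.Nat.Divisibility using (_∣_; _∣?_)
open import Data.Nat.Properties as ℕ using (_≤?_)
open import Data.Product.Base using (_×_; _,_; proj₁; proj₂; ∃)
open import Data.Product.Properties using (≡-dec)
open import Data.Sum.Base using (_⊎_; inj₁; inj₂; swap; [_,_]′)
open import Data.Vec.Base using (Vec; []; _∷_; lookup; here; there)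
open import Data.Vec.Relation.Unary.Linked using (Linked; linked?)
open import Function.Base using (_∘_; id; case_of_)
open import Relation.Binary.Bundles using (DecSetoid)
open import Relation.Binary.Construct.Closure.ReflexiveTransitive as Star using (Star; ε; _◅_; _◅◅_)
open import Relation.Binary.Definitions using (Decidable)
open import Relation.Binary.PropositionalEquality using (_≡_; _≢_; refl; sym; trans; cong; cong₂; subst)
open import Relation.Binary.Structures using (IsEquivalence)
open import Relation.Nullary.Decidable using (Dec; yes; no; ¬?; map′; _×-dec_; _⊎-dec_; _→-dec_)
open import Relation.Nullary.Negation using (¬_; contradiction)
import Algebra.Properties.CommutativeMonoid.Sum as Sum

------------------------------------------------------------------------
-- Finite simple graphs

record Graph : Set where
  field
    order : ℕ
    size  : ℕ
    ends  : Fin size → Fin order × Fin order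

  Vertex : Set
  Vertex = Fin order

  Edge : Set
  Edge = Fin size

  -- Edges are undirected: the order in which `ends` lists the two endpoints
  -- carries no meaning.
  Joins : Edge → Vertex → Vertex → Set
  Joins e a b = ends e ≡ (a , b) ⊎ ends e ≡ (b , a)

  field
    loopless : ∀ {e a} → ¬ Joins e a a
    simple   : ∀ {e e′ a b} → Joins e a b → Joins e′ a b → e ≡ e′

------------------------------------------------------------------------
-- Classes of a decidable equivalence relation on Fin n

numClasses : ∀ {n} {R : Fin n → Fin n → Set} → Decidable R → ℕ
numClasses {n} R? = length (deduplicate R? (allFin n))

Transversal : {A : Set} (R : A → A → Set) → List A → Set
Transversal R xs = AllPairs (λ x y → ¬ R x y) xs × (∀ v → Any (R v) xs)

module _ {A : Set} where

  any-─ : {P Q : A → Set} (xs : List A) (p : Any P xs) (q : Any Q xs) →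
          (∀ {y} → P y → Q y → Any Q (xs ─ p)) → Any Q (xs ─ p)
  any-─ (x ∷ xs) (here px) (here qx) f = f px qx
  any-─ (x ∷ xs) (here px) (there q) f = q
  any-─ (x ∷ xs) (there p) (here qx) f = here qx
  any-─ {P} {Q} (x ∷ xs) (there p) (there q) f = case split xs p q of λ where
      (inj₁ r) → there r
      (inj₂ (y , py , qy)) → f py qy
    where
    split : ∀ xs (p : Any P xs) → Any Q xs → Any Q (xs ─ p) ⊎ ∃ λ y → P y × Q y
    split (x ∷ xs) (here px) (here qx) = inj₂ (x , px , qx)
    split (x ∷ xs) (here px) (there q) = inj₁ q
    split (x ∷ xs) (there p) (here qx) = inj₁ (here qx)
    split (x ∷ xs) (there p) (there q) with split xs p q
    ... | inj₁ r = inj₁ (there r)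
    ... | inj₂ r = inj₂ r

  allPairs-─ : {P : A → Set} {R : A → A → Set} {xs : List A} (p : Any P xs) →
               AllPairs R xs → AllPairs R (xs ─ p)
  allPairs-─ (here px) (r ∷ rs) = rs
  allPairs-─ {xs = x ∷ xs} (there p) (r ∷ rs) = All─ p r ∷ allPairs-─ p rs
    where
    All─ : {P Q : A → Set} {xs : List A} (p : Any P xs) → All Q xs → All Q (xs ─ p)
    All─ (here _)  (_ ∷ qs) = qs
    All─ (there p) (q ∷ qs) = q ∷ All─ p qs

  length-─ : {P : A → Set} (xs : List A) (p : Any P xs) → length xs ≡ suc (length (xs ─ p))
  length-─ xs p = length-removeAt′ xs (Any.index p)

  independent≤cover : {R : A → A → Set} → IsEquivalence R → (xs ys : List A) →
                      AllPairs (λ x y → ¬ R x y) xs → All (λ x → Any (R x) ys) xs →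
                      length xs ≤ length ys
  independent≤cover eq [] ys _ _ = z≤n
  independent≤cover {R} eq (x ∷ xs) ys (x# ∷ xs#) (p ∷ ps) =
    subst (suc (length xs) ≤_) (sym (length-─ ys p))
      (s≤s (independent≤cover eq xs (ys ─ p) xs#
        (All.zipWith (λ (¬r , q) → any-─ ys p q
            (λ rxy rx′y → contradiction (E.trans rxy (E.sym rx′y)) ¬r))
          (x# , ps))))
    where module E = IsEquivalence eq

module _ {n : ℕ} {R : Fin n → Fin n → Set} (eq : IsEquivalence R) (R? : Decidable R) where

  private
    module E = IsEquivalence eq
    DS : DecSetoid _ _
    DS = record { Carrier = Fin n ; _≈_ = R
                ; isDecEquivalence = record { isEquivalence = eq ; _≟_ = R? } }

  reps : List (Fin n)
  reps = deduplicate R? (allFin n)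

  reps-transversal : Transversal R reps
  reps-transversal = deduplicate-! DS (allFin n) , λ v →
    Any.deduplicate⁺ R? (λ r q → E.trans q (E.sym r)) (Any.map E.reflexive (∈-allFin v))

  numClasses≤n : numClasses R? ≤ n
  numClasses≤n = subst (numClasses R? ≤_) (length-tabulate id)
    (independent≤cover eq reps (allFin n) (proj₁ reps-transversal)
      (All.tabulate (λ {x} _ → Any.map E.reflexive (∈-allFin x))))

module _ {n : ℕ} {R S : Fin n → Fin n → Set}
         (eqR : IsEquivalence R) (R? : Decidable R)
         (eqS : IsEquivalence S) (S? : Decidable S)
         (R⇒S : ∀ {x y} → R x y → S x y) where

  private
    module R = IsEquivalence eqR
    module S = IsEquivalence eqS
    xs = reps eqR R?
    xs# = proj₁ (reps-transversal eqR R?)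
    xs∋ = proj₂ (reps-transversal eqR R?)
    ys = reps eqS S?
    ys# = proj₁ (reps-transversal eqS S?)
    ys∋ = proj₂ (reps-transversal eqS S?)

  numClasses-antimono : numClasses S? ≤ numClasses R?
  numClasses-antimono = independent≤cover eqS ys xs ys# (All.tabulate (λ {x} _ → Any.map R⇒S (xs∋ x)))

  -- S arises from R by merging the classes of a and b.
  module _ (a b : Fin n) (Sab : S a b)
           (merge : ∀ {x y} → S x y → R x y ⊎ (R x a × R b y ⊎ R x b × R a y)) where

    private
      lone : ∀ (zs : List (Fin n)) (p : Any (R a) zs) → AllPairs (λ x y → ¬ R x y) zs →
             All (λ z → ¬ R a z) (zs ─ p)
      lone (z ∷ zs) (here az) (z# ∷ _) = All.map (λ ¬zx ax → ¬zx (R.trans (R.sym az) ax)) z#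
      lone (z ∷ zs) (there p) (z# ∷ zs#) =
        (λ az → hit zs p (All.map (λ ¬zy ay → ¬zy (R.trans (R.sym az) ay)) z#)) ∷ lone zs p zs#
        where
        hit : ∀ zs → Any (R a) zs → ¬ All (λ z → ¬ R a z) zs
        hit (z ∷ zs) (here az) (n ∷ _) = n az
        hit (z ∷ zs) (there p) (_ ∷ ns) = hit zs p ns

      indep : ∀ (zs : List (Fin n)) → All (λ z → ¬ R a z) zs →
              AllPairs (λ x y → ¬ R x y) zs → AllPairs (λ x y → ¬ S x y) zs
      indep [] _ _ = []
      indep (z ∷ zs) (¬az ∷ ¬azs) (z# ∷ zs#) =
        All.zipWith (λ (¬zy , ¬ay) s → case merge s of λ where
            (inj₁ r) → ¬zy r
            (inj₂ (inj₁ (za , _))) → ¬az (R.sym za)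
            (inj₂ (inj₂ (_ , ay))) → ¬ay ay)
          (z# , ¬azs)
        ∷ indep zs ¬azs zs#

    numClasses-merge≤ : numClasses R? ≤ suc (numClasses S?)
    numClasses-merge≤ = subst (_≤ suc (length ys)) (sym (length-─ xs p))
      (s≤s (independent≤cover eqS (xs ─ p) ys
        (indep (xs ─ p) (lone xs p xs#) (allPairs-─ p xs#))
        (All.tabulate (λ {x} _ → ys∋ x))))
      where p = xs∋ a

    numClasses-merge< : ¬ R a b → suc (numClasses S?) ≤ numClasses R?
    numClasses-merge< ¬ab = subst (suc (length ys) ≤_) (sym (length-─ xs p))
      (s≤s (independent≤cover eqS ys (xs ─ p) ys#
        (All.tabulate (λ {y} _ → cover y))))
      where
      p = xs∋ a
      b∈ : Any (R b) (xs ─ p)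
      b∈ = any-─ xs p (xs∋ b) (λ ay by → contradiction (R.trans ay (R.sym by)) ¬ab)
      cover : ∀ y → Any (S y) (xs ─ p)
      cover y = any-─ xs p (Any.map R⇒S (xs∋ y)) λ az Syz →
        Any.map (λ bw → S.trans Syz (S.trans (S.sym (R⇒S az)) (S.trans Sab (R⇒S bw)))) b∈

------------------------------------------------------------------------
-- Connectivity along a list of edges

module _ {n : ℕ} where

  open List∈ using () renaming (_∈_ to _∈ₗ_)

  private
    EdgeList : Set
    EdgeList = List (Fin n × Fin n)

  Link : EdgeList → Fin n → Fin n → Set
  Link es a b = (a , b) ∈ₗ es ⊎ (b , a) ∈ₗ es

  Conn : EdgeList → Fin n → Fin n → Set
  Conn es = Star (Link es)

  conn-isEquivalence : ∀ es → IsEquivalence (Conn es)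
  conn-isEquivalence es = record { refl = ε ; sym = Star.reverse swap ; trans = _◅◅_ }

  private
    module C es = IsEquivalence (conn-isEquivalence es)

  conn-mono : ∀ {es fs} → (∀ {p} → p ∈ₗ es → p ∈ₗ fs) → ∀ {u v} → Conn es u v → Conn fs u v
  conn-mono f = Star.map [ inj₁ ∘ f , inj₂ ∘ f ]′

  conn-merge : ∀ {a b es u v} → Conn ((a , b) ∷ es) u v →
               Conn es u v ⊎ (Conn es u a × Conn es b v ⊎ Conn es u b × Conn es a v)
  conn-merge ε = inj₁ ε
  conn-merge {es = es} (l ◅ ls) with conn-merge ls
  conn-merge (inj₁ (here refl) ◅ ls) | inj₁ r                = inj₂ (inj₁ (ε , r))
  conn-merge (inj₁ (here refl) ◅ ls) | inj₂ (inj₁ (_ , r))   = inj₂ (inj₁ (ε , r))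
  conn-merge (inj₁ (here refl) ◅ ls) | inj₂ (inj₂ (_ , r))   = inj₁ r
  conn-merge (inj₂ (here refl) ◅ ls) | inj₁ r                = inj₂ (inj₂ (ε , r))
  conn-merge (inj₂ (here refl) ◅ ls) | inj₂ (inj₁ (_ , r))   = inj₁ r
  conn-merge (inj₂ (here refl) ◅ ls) | inj₂ (inj₂ (_ , r))   = inj₂ (inj₂ (ε , r))
  conn-merge (inj₁ (there i) ◅ ls)   | inj₁ r                = inj₁ (inj₁ i ◅ r)
  conn-merge (inj₁ (there i) ◅ ls)   | inj₂ (inj₁ (q , r))   = inj₂ (inj₁ (inj₁ i ◅ q , r))
  conn-merge (inj₁ (there i) ◅ ls)   | inj₂ (inj₂ (q , r))   = inj₂ (inj₂ (inj₁ i ◅ q , r))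
  conn-merge (inj₂ (there i) ◅ ls)   | inj₁ r                = inj₁ (inj₂ i ◅ r)
  conn-merge (inj₂ (there i) ◅ ls)   | inj₂ (inj₁ (q , r))   = inj₂ (inj₁ (inj₂ i ◅ q , r))
  conn-merge (inj₂ (there i) ◅ ls)   | inj₂ (inj₂ (q , r))   = inj₂ (inj₂ (inj₂ i ◅ q , r))

  conn-link : ∀ {a b es} → Conn ((a , b) ∷ es) a b
  conn-link = inj₁ (here refl) ◅ ε

  conn-unmerge : ∀ {a b es u v} →
                 Conn es u v ⊎ (Conn es u a × Conn es b v ⊎ Conn es u b × Conn es a v) →
                 Conn ((a , b) ∷ es) u v
  conn-unmerge (inj₁ r)              = conn-mono there r
  conn-unmerge (inj₂ (inj₁ (q , r))) = conn-mono there q ◅◅ conn-link ◅◅ conn-mono there r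
  conn-unmerge {a} {b} {es} (inj₂ (inj₂ (q , r))) =
    conn-mono there q ◅◅ C.sym ((a , b) ∷ es) conn-link ◅◅ conn-mono there r

  conn? : ∀ es → Decidable (Conn es)
  conn? [] u v = map′ (λ { refl → ε }) (λ { ε → refl ; (inj₁ () ◅ _) ; (inj₂ () ◅ _) }) (u Fin.≟ v)
  conn? ((a , b) ∷ es) u v = map′ conn-unmerge conn-merge
    (conn? es u v ⊎-dec ((conn? es u a ×-dec conn? es b v) ⊎-dec (conn? es u b ×-dec conn? es a v)))

  κ : EdgeList → ℕ
  κ es = numClasses (conn? es)

  κ≤n : ∀ es → κ es ≤ n
  κ≤n es = numClasses≤n (conn-isEquivalence es) (conn? es)

  κ-antimono′ : ∀ es fs → (∀ {u v} → Conn es u v → Conn fs u v) → κ fs ≤ κ es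
  κ-antimono′ es fs f = numClasses-antimono (conn-isEquivalence es) (conn? es)
    (conn-isEquivalence fs) (conn? fs) f

  κ-antimono : ∀ es fs → (∀ {p} → p ∈ₗ es → p ∈ₗ fs) → κ fs ≤ κ es
  κ-antimono es fs f = κ-antimono′ es fs (conn-mono f)

  κ-merge≤ : ∀ a b es → κ es ≤ suc (κ ((a , b) ∷ es))
  κ-merge≤ a b es = numClasses-merge≤ (conn-isEquivalence es) (conn? es)
    (conn-isEquivalence _) (conn? _) (conn-mono there) a b conn-link conn-merge

  κ-merge< : ∀ a b es → ¬ Conn es a b → suc (κ ((a , b) ∷ es)) ≤ κ es
  κ-merge< a b es = numClasses-merge< (conn-isEquivalence es) (conn? es)
    (conn-isEquivalence _) (conn? _) (conn-mono there) a b conn-link conn-merge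

  κ-[] : n ≤ κ []
  κ-[] = subst (_≤ κ []) (length-tabulate id)
    (independent≤cover (conn-isEquivalence []) (allFin n) (reps (conn-isEquivalence []) (conn? []))
      (indep (allFin n) (Unique.allFin⁺ n))
      (All.tabulate (λ {x} _ → proj₂ (reps-transversal (conn-isEquivalence []) (conn? [])) x)))
    where
    import Data.List.Relation.Unary.Unique.Propositional.Properties as Unique
    import Data.List.Relation.Unary.AllPairs as AllPairs
    indep : ∀ xs → AllPairs _≢_ xs → AllPairs (λ x y → ¬ Conn [] x y) xs
    indep xs = AllPairs.map λ where
      x≢y ε → x≢y refl
      x≢y (inj₁ () ◅ _)
      x≢y (inj₂ () ◅ _)

  n≤length+κ : ∀ es → n ≤ length es + κ es
  n≤length+κ [] = κ-[]
  n≤length+κ ((a , b) ∷ es) = begin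
    n                                      ≤⟨ n≤length+κ es ⟩
    length es + κ es                       ≤⟨ ℕ.+-monoʳ-≤ (length es) (κ-merge≤ a b es) ⟩
    length es + suc (κ ((a , b) ∷ es))     ≡⟨ ℕ.+-suc (length es) _ ⟩
    suc (length es) + κ ((a , b) ∷ es)     ∎
    where open ℕ.≤-Reasoning

  κ-step : ∀ a b es fs → (∀ {p} → p ∈ₗ es → p ∈ₗ fs) →
           κ fs + κ ((a , b) ∷ es) ≤ κ es + κ ((a , b) ∷ fs)
  κ-step a b es fs es⊆fs with conn? es a b
  ... | no ¬ab = begin
    κ fs + κ ((a , b) ∷ es)            ≤⟨ ℕ.+-monoˡ-≤ _ (κ-merge≤ a b fs) ⟩
    suc (κ ((a , b) ∷ fs)) + κ ((a , b) ∷ es) ≡⟨ sym (ℕ.+-suc (κ ((a , b) ∷ fs)) _) ⟩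
    κ ((a , b) ∷ fs) + suc (κ ((a , b) ∷ es)) ≤⟨ ℕ.+-monoʳ-≤ (κ ((a , b) ∷ fs)) (κ-merge< a b es ¬ab) ⟩
    κ ((a , b) ∷ fs) + κ es            ≡⟨ ℕ.+-comm (κ ((a , b) ∷ fs)) _ ⟩
    κ es + κ ((a , b) ∷ fs)            ∎
    where open ℕ.≤-Reasoning
  ... | yes ab = begin
    κ fs + κ ((a , b) ∷ es)            ≤⟨ ℕ.+-mono-≤ (κ-antimono′ ((a , b) ∷ fs) fs absorb)
                                                     (κ-antimono es ((a , b) ∷ es) there) ⟩
    κ ((a , b) ∷ fs) + κ es            ≡⟨ ℕ.+-comm (κ ((a , b) ∷ fs)) _ ⟩
    κ es + κ ((a , b) ∷ fs)            ∎
    where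
    open ℕ.≤-Reasoning
    ab′ : Conn fs a b
    ab′ = conn-mono es⊆fs ab
    absorb : ∀ {u v} → Conn ((a , b) ∷ fs) u v → Conn fs u v
    absorb c = case conn-merge c of λ where
      (inj₁ r)              → r
      (inj₂ (inj₁ (q , r))) → q ◅◅ ab′ ◅◅ r
      (inj₂ (inj₂ (q , r))) → q ◅◅ C.sym fs ab′ ◅◅ r

  κ-diminishing : ∀ xs es fs → (∀ {p} → p ∈ₗ es → p ∈ₗ fs) →
                  κ fs + κ (xs ++ es) ≤ κ es + κ (xs ++ fs)
  κ-diminishing [] es fs _ = ℕ.≤-reflexive (ℕ.+-comm (κ fs) (κ es))
  κ-diminishing ((a , b) ∷ xs) es fs es⊆fs = ℕ.+-cancelʳ-≤ (κ (xs ++ es) + κ (xs ++ fs)) _ _ (begin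
    (F + E′) + (E + F₀)      ≡⟨ shuffle F E′ E F₀ ⟩
    (F + E) + (F₀ + E′)      ≤⟨ ℕ.+-mono-≤ (κ-diminishing xs es fs es⊆fs) (κ-step a b (xs ++ es) (xs ++ fs) mono) ⟩
    (κ es + F₀) + (E + F′)   ≡⟨ shuffle′ (κ es) F₀ E F′ ⟩
    (κ es + F′) + (E + F₀)   ∎)
    where
    open ℕ.≤-Reasoning
    open import Data.Nat.Tactic.RingSolver using (solve-∀)
    F E F₀ E′ F′ : ℕ
    F  = κ fs
    E  = κ (xs ++ es)
    F₀ = κ (xs ++ fs)
    E′ = κ ((a , b) ∷ xs ++ es)
    F′ = κ ((a , b) ∷ xs ++ fs)
    shuffle : ∀ p q r s → (p + q) + (r + s) ≡ (p + r) + (s + q)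
    shuffle = solve-∀
    shuffle′ : ∀ p q r s → (p + q) + (r + s) ≡ (p + s) + (r + q)
    shuffle′ = solve-∀
    mono : ∀ {p} → p ∈ₗ xs ++ es → p ∈ₗ xs ++ fs
    mono i with ∈-++⁻ xs i
    ... | inj₁ j = ∈-++⁺ˡ j
    ... | inj₂ j = ∈-++⁺ʳ xs (es⊆fs j)

  edgeList : ∀ {m} → (Fin m → Fin n × Fin n) → Subset m → EdgeList
  edgeList ends []            = []
  edgeList ends (inside ∷ A)  = ends zero ∷ edgeList (ends ∘ suc) A
  edgeList ends (outside ∷ A) = edgeList (ends ∘ suc) A

  length-edgeList : ∀ {m} (ends : Fin m → Fin n × Fin n) A → length (edgeList ends A) ≡ ∣ A ∣
  length-edgeList ends []            = refl
  length-edgeList ends (inside ∷ A)  = cong suc (length-edgeList (ends ∘ suc) A)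
  length-edgeList ends (outside ∷ A) = length-edgeList (ends ∘ suc) A

  ∈-edgeList⁻ : ∀ {m} (ends : Fin m → Fin n × Fin n) A {p} → p ∈ₗ edgeList ends A →
                ∃ λ e → e ∈ A × ends e ≡ p
  ∈-edgeList⁻ ends (inside ∷ A) (here refl) = zero , here , refl
  ∈-edgeList⁻ ends (inside ∷ A) (there i) with ∈-edgeList⁻ (ends ∘ suc) A i
  ... | e , e∈A , eq = suc e , there e∈A , eq
  ∈-edgeList⁻ ends (outside ∷ A) i with ∈-edgeList⁻ (ends ∘ suc) A i
  ... | e , e∈A , eq = suc e , there e∈A , eq

  ∈-edgeList⁺ : ∀ {m} (ends : Fin m → Fin n × Fin n) A {e} → e ∈ A → ends e ∈ₗ edgeList ends A
  ∈-edgeList⁺ ends (inside ∷ A)  here      = here refl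
  ∈-edgeList⁺ ends (inside ∷ A)  (there i) = there (∈-edgeList⁺ (ends ∘ suc) A i)
  ∈-edgeList⁺ ends (outside ∷ A) (there i) = ∈-edgeList⁺ (ends ∘ suc) A i

------------------------------------------------------------------------
-- Connected components and rank of a graph

module _ (G : Graph) where

  open Graph G

  Adjacent : Subset size → Vertex → Vertex → Set
  Adjacent A a b = ∃ λ e → e ∈ A × Joins e a b

  Connected : Subset size → Vertex → Vertex → Set
  Connected A = Star (Adjacent A)

  connected⇒conn : ∀ A {u v} → Connected A u v → Conn (edgeList ends A) u v
  connected⇒conn A = Star.map λ where
    (e , e∈A , inj₁ eq) → inj₁ (subst (List∈._∈ _) eq (∈-edgeList⁺ ends A e∈A))
    (e , e∈A , inj₂ eq) → inj₂ (subst (List∈._∈ _) eq (∈-edgeList⁺ ends A e∈A))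

  conn⇒connected : ∀ A {u v} → Conn (edgeList ends A) u v → Connected A u v
  conn⇒connected A = Star.map λ where
    (inj₁ i) → let e , e∈A , eq = ∈-edgeList⁻ ends A i in e , e∈A , inj₁ eq
    (inj₂ i) → let e , e∈A , eq = ∈-edgeList⁻ ends A i in e , e∈A , inj₂ eq

  connected-isEquivalence : ∀ A → IsEquivalence (Connected A)
  connected-isEquivalence A = record
    { refl = ε ; sym = Star.reverse (λ (e , e∈A , j) → e , e∈A , swap j) ; trans = _◅◅_ }

  connected? : ∀ A → Decidable (Connected A)
  connected? A u v = map′ (conn⇒connected A) (connected⇒conn A) (conn? (edgeList ends A) u v)

  -- The number of components of (V, A), counting one vertex for each class
  -- of the relation `Connected A`.
  components : Subset size → ℕ
  components A = length (deduplicate (connected? A) (allFin order))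

  rank : Subset size → ℕ
  rank A = order ∸ components A

  private
    el : Subset size → List (Vertex × Vertex)
    el = edgeList ends

  components≡κ : ∀ A → components A ≡ κ (el A)
  components≡κ A = ℕ.≤-antisym
    (numClasses-antimono (conn-isEquivalence (el A)) (conn? (el A))
      (connected-isEquivalence A) (connected? A) (conn⇒connected A))
    (numClasses-antimono (connected-isEquivalence A) (connected? A)
      (conn-isEquivalence (el A)) (conn? (el A)) (connected⇒conn A))

  components≤order : ∀ A → components A ≤ order
  components≤order A = numClasses≤n (connected-isEquivalence A) (connected? A)

  rank+components : ∀ A → rank A + components A ≡ order
  rank+components A = ℕ.m∸n+n≡m (components≤order A)

  rank-≤ : ∀ A → rank A ≤ ∣ A ∣
  rank-≤ A = ℕ.m≤n+o⇒m∸n≤o order (components A) (begin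
    order                          ≤⟨ n≤length+κ (el A) ⟩
    length (el A) + κ (el A)       ≡⟨ cong₂ _+_ (length-edgeList ends A) (sym (components≡κ A)) ⟩
    ∣ A ∣ + components A            ≡⟨ ℕ.+-comm ∣ A ∣ _ ⟩
    components A + ∣ A ∣            ∎)
    where open ℕ.≤-Reasoning

  rank-mono : ∀ {A B} → A ⊆ B → rank A ≤ rank B
  rank-mono {A} {B} A⊆B = ℕ.∸-monoʳ-≤ order
    (numClasses-antimono (connected-isEquivalence A) (connected? A)
      (connected-isEquivalence B) (connected? B)
      (Star.map (λ (e , e∈A , j) → e , A⊆B e∈A , j)))

  components-supermodular : ∀ A B →
    components A + components B ≤ components (A ∪ B) + components (A ∩ B)
  components-supermodular A B
    rewrite components≡κ A | components≡κ B | components≡κ (A ∪ B) | components≡κ (A ∩ B) = begin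
    κ (el A) + κ (el B)                  ≡⟨ ℕ.+-comm (κ (el A)) _ ⟩
    κ (el B) + κ (el A)                  ≤⟨ ℕ.+-monoʳ-≤ (κ (el B)) (κ-antimono (el A ++ el (A ∩ B)) (el A) ∩-absorb) ⟩
    κ (el B) + κ (el A ++ el (A ∩ B))    ≤⟨ κ-diminishing (el A) (el (A ∩ B)) (el B) (lift (p∩q⊆q A B)) ⟩
    κ (el (A ∩ B)) + κ (el A ++ el B)    ≤⟨ ℕ.+-monoʳ-≤ (κ (el (A ∩ B))) (κ-antimono (el (A ∪ B)) (el A ++ el B) ∪-split) ⟩
    κ (el (A ∩ B)) + κ (el (A ∪ B))      ≡⟨ ℕ.+-comm (κ (el (A ∩ B))) _ ⟩
    κ (el (A ∪ B)) + κ (el (A ∩ B))      ∎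
    where
    open ℕ.≤-Reasoning
    open List∈ using () renaming (_∈_ to _∈ₗ_)
    lift : ∀ {C D} → C ⊆ D → ∀ {p} → p ∈ₗ el C → p ∈ₗ el D
    lift {C} {D} C⊆D i with ∈-edgeList⁻ ends C i
    ... | e , e∈C , refl = ∈-edgeList⁺ ends D (C⊆D e∈C)
    ∩-absorb : ∀ {p} → p ∈ₗ el A ++ el (A ∩ B) → p ∈ₗ el A
    ∩-absorb i with ∈-++⁻ (el A) i
    ... | inj₁ j = j
    ... | inj₂ j = lift (p∩q⊆p A B) j
    ∪-split : ∀ {p} → p ∈ₗ el (A ∪ B) → p ∈ₗ el A ++ el B
    ∪-split i with ∈-edgeList⁻ ends (A ∪ B) i
    ... | e , e∈ , refl with x∈p∪q⁻ A B e∈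
    ...   | inj₁ e∈A = ∈-++⁺ˡ (∈-edgeList⁺ ends A e∈A)
    ...   | inj₂ e∈B = ∈-++⁺ʳ (el A) (∈-edgeList⁺ ends B e∈B)

  rank-submod : ∀ A B → rank (A ∪ B) + rank (A ∩ B) ≤ rank A + rank B
  rank-submod A B = ℕ.+-cancelʳ-≤ (components A + components B) _ _ (begin
    (rank (A ∪ B) + rank (A ∩ B)) + (components A + components B)
      ≤⟨ ℕ.+-monoʳ-≤ (rank (A ∪ B) + rank (A ∩ B)) (components-supermodular A B) ⟩
    (rank (A ∪ B) + rank (A ∩ B)) + (components (A ∪ B) + components (A ∩ B))
      ≡⟨ shuffle (rank (A ∪ B)) _ _ _ ⟩
    (rank (A ∪ B) + components (A ∪ B)) + (rank (A ∩ B) + components (A ∩ B))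
      ≡⟨ cong₂ _+_ (trans (rank+components (A ∪ B)) (sym (rank+components A)))
                   (trans (rank+components (A ∩ B)) (sym (rank+components B))) ⟩
    (rank A + components A) + (rank B + components B)
      ≡⟨ shuffle (rank A) _ _ _ ⟩
    (rank A + rank B) + (components A + components B) ∎)
    where
    open ℕ.≤-Reasoning
    open import Data.Nat.Tactic.RingSolver using (solve-∀)
    shuffle : ∀ p q r s → (p + q) + (r + s) ≡ (p + r) + (q + s)
    shuffle = solve-∀

------------------------------------------------------------------------
-- Matroids, given by their rank function

record Matroid : Set where
  field
    size      : ℕ
    rk        : Subset size → ℕ
    rk-≤      : ∀ A → rk A ≤ ∣ A ∣
    rk-mono   : ∀ {A B} → A ⊆ B → rk A ≤ rk B
    rk-submod : ∀ A B → rk (A ∪ B) + rk (A ∩ B) ≤ rk A + rk B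

graphicMatroid : Graph → Matroid
graphicMatroid G = record
  { size      = Graph.size G
  ; rk        = rank G
  ; rk-≤      = rank-≤ G
  ; rk-mono   = rank-mono G
  ; rk-submod = rank-submod G
  }

------------------------------------------------------------------------
-- The matroid polynomials, as functions of integer arguments

open Sum ℤ.*-1-commutativeMonoid public using () renaming (sum to ∏)

∑ : {A : Set} → List A → (A → ℤ) → ℤ
∑ xs f = List.foldr (λ x s → f x +ℤ s) 0ℤ xs

tuples : {A : Set} (k : ℕ) → List A → List (Vec A k)
tuples zero    xs = [] ∷ []
tuples (suc k) xs = cartesianProductWith _∷_ xs (tuples k xs)

subsets : (m : ℕ) → List (Subset m)
subsets m = tuples m (outside ∷ inside ∷ [])

-- All A₁ ⊆ A₂ ⊆ … ⊆ Aₖ, with A₁ at the head of the vector.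
chains : (k m : ℕ) → List (Vec (Subset m) k)
chains k m = filter (linked? _⊆?_) (tuples k (subsets m))

module _ (M : Matroid) {k : ℕ} where

  open Matroid M

  χᴹ : (Fin k → ℤ) → ℤ
  χᴹ t = ∑ (chains k size) λ As → ∏ λ i →
    let A = lookup As i in
    (-1ℤ ^ℤ ∣ A ∣) *ℤ (t i ^ℤ (rk ⊤ ∸ rk A))

  Tᴹ : (x y : Fin k → ℤ) → ℤ
  Tᴹ x y = ∑ (chains k size) λ As → ∏ λ i →
    let A = lookup As i in
    ((x i - 1ℤ) ^ℤ (rk ⊤ ∸ rk A)) *ℤ ((y i - 1ℤ) ^ℤ (∣ A ∣ ∸ rk A))

------------------------------------------------------------------------
-- Coupled multicolorings

-- The 1-based position of i, so that parities agree with f₁, …, fₖ.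
index : ∀ {k} → Fin k → ℕ
index i = suc (toℕ i)

Even Odd : ℕ → Set
Even n = 2 ∣ n
Odd  n = ¬ Even n

module _ (G : Graph) where

  open Graph G

  Multicoloring : ∀ {k} → (Fin k → Set) → Set
  Multicoloring C = ∀ i → Vertex → C i

  module _ {k : ℕ} {C : Fin k → Set} (f : Multicoloring C) (a b : Vertex) where

    AgreeOdd : ℕ → Set
    AgreeOdd j = ∀ i → Odd (index i) → index i ≤ j → f i a ≡ f i b

    CoupledEven : Set
    CoupledEven = ∀ i → Even (index i) → AgreeOdd (index i ∸ 1) → f i a ≡ f i b

    CoupledLast : Set
    CoupledLast = Odd k → ∀ i → index i ≡ k → AgreeOdd (k ∸ 2) → f i a ≢ f i b

  Coupled : ∀ {k} {C : Fin k → Set} → Multicoloring C → Set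
  Coupled {1} f = ∀ a b → Adjacent G ⊤ a b → f zero a ≢ f zero b
  Coupled     f = ∀ a b → Adjacent G ⊤ a b → CoupledEven f a b × CoupledLast f a b

  adjacent? : ∀ A → Decidable (Adjacent G A)
  adjacent? A a b = Fin.any? λ e → (e ∈? A) ×-dec ((ends e ≟ (a , b)) ⊎-dec (ends e ≟ (b , a)))
    where _≟_ = ≡-dec Fin._≟_ Fin._≟_

  module _ {k : ℕ} {t : Fin k → ℕ} (f : Multicoloring (Fin ∘ t)) (a b : Vertex) where

    agreeOdd? : ∀ j → Dec (AgreeOdd f a b j)
    agreeOdd? j = Fin.all? λ i →
      ¬? (2 ∣? index i) →-dec ((index i ≤? j) →-dec (f i a Fin.≟ f i b))

    coupledEven? : Dec (CoupledEven f a b)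
    coupledEven? = Fin.all? λ i →
      (2 ∣? index i) →-dec (agreeOdd? (index i ∸ 1) →-dec (f i a Fin.≟ f i b))

    coupledLast? : Dec (CoupledLast f a b)
    coupledLast? = ¬? (2 ∣? k) →-dec Fin.all? λ i →
      (index i ℕ.≟ k) →-dec (agreeOdd? (k ∸ 2) →-dec ¬? (f i a Fin.≟ f i b))

  coupled? : ∀ {k} {t : Fin k → ℕ} (f : Multicoloring (Fin ∘ t)) → Dec (Coupled f)
  coupled? {0} f = Fin.all? λ a → Fin.all? λ b →
    adjacent? ⊤ a b →-dec (coupledEven? f a b ×-dec coupledLast? f a b)
  coupled? {1} f = Fin.all? λ a → Fin.all? λ b →
    adjacent? ⊤ a b →-dec ¬? (f zero a Fin.≟ f zero b)
  coupled? {suc (suc _)} f = Fin.all? λ a → Fin.all? λ b →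
    adjacent? ⊤ a b →-dec (coupledEven? f a b ×-dec coupledLast? f a b)

  -- Every multicoloring with color sets Fin (t i) occurs exactly once, up to
  -- pointwise equality: finToFun is inverse to funToFin.
  multicolorings : ∀ {k} (t : Fin k → ℕ) → List (Multicoloring (Fin ∘ t))
  multicolorings {zero}  t = (λ ()) ∷ []
  multicolorings {suc k} t = cartesianProductWith cons
      (List.map finToFun (allFin _)) (multicolorings (t ∘ suc))
    where
    cons : (Vertex → Fin (t zero)) → Multicoloring (Fin ∘ t ∘ suc) → Multicoloring (Fin ∘ t)
    cons f fs zero    = f
    cons f fs (suc i) = fs i

  χᴳ : ∀ {k} → (Fin k → ℕ) → ℕ
  χᴳ t = length (filter coupled? (multicolorings t))

{-# OPTIONS --safe #-}

-- For an edge {a, b}, let r be the length of the longest initial run of colors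
-- f₁, …, f_r that agree on a and b. The coupling conditions say exactly that r is
-- even for every edge, and the indicator of this is Σ_{j ≤ r} (-1)^j. Peeling off
-- f₁, this alternating sum is g = 1 - [f₁(a) = f₁(b)] g′, with g′ the same quantity
-- for f₂, …, f_k. Expanding ∏_{e ∈ S} (1 - x_e) = Σ_{T ⊆ S} (-1)^|T| ∏_{e ∈ T} x_e and
-- summing over f₁ yields a factor t₁^c(T), because the colorings that are
-- monochromatic on T are those constant on its components. Induction on k gives
-- the sum of ∏ (-1)^|Bᵢ| tᵢ^c(Bᵢ) over descending chains B₁ ⊇ … ⊇ B_k, which
-- explains the reversal of t₁, …, t_k.

module Submission where

open import Defs
open import Data.Bool.Base using (if_then_else_)
open import Data.Fin.Base using (Fin; zero; suc; fromℕ; inject₁; opposite; funToFin; finToFun; combine)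
open import Data.Fin.Patterns using (1F)
open import Data.Fin.Permutation using (reverse)
open import Data.Fin.Properties as Fin using (opposite-involutive; funToFin-finToFin; finToFun-funToFin)
open import Data.Fin.Subset using (Subset; ⊤; ⊥; inside; outside; _∈_; _⊆_; ∣_∣)
open import Data.Fin.Subset.Properties using (_∈?_; _⊆?_; ⊆⊤; ⊥⊆; ∈⊤; drop-∷-⊆; s⊆s; out⊆)
open import Data.Integer.Base using (ℤ; +_; 0ℤ; 1ℤ; -1ℤ; _+_; _-_; _*_; _^_; -_)
open import Data.Integer.Properties as ℤ
  using (*-identityˡ; *-zeroˡ; *-zeroʳ; *-distribˡ-+; +-identityˡ; +-identityʳ; +-assoc;
         *-1-commutativeMonoid; ^-distribˡ-+-*; ^-*-assoc; ^-zeroˡ; pos-*)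
open import Data.Integer.Tactic.RingSolver using (solve-∀)
open import Data.List.Base as List using (List; []; _∷_; _++_; length; filter; map; allFin; cartesianProductWith)
open import Data.List.Membership.Propositional using () renaming (_∈_ to _∈ₗ_)
open import Data.List.Membership.Propositional.Properties using (∈-allFin; ∈-map⁺; ∈-map⁻; ∈-lookup; ∈-filter⁺; ∈-filter⁻)
open import Data.List.Properties using (length-map; length-tabulate)
open import Data.List.Relation.Unary.All as All using (All; []; _∷_)
open import Data.List.Relation.Unary.AllPairs using (AllPairs; []; _∷_)
open import Data.List.Relation.Unary.Any as Any using (Any)
open import Data.List.Relation.Unary.Any.Properties using (lookup-index)
open import Data.List.Relation.Unary.Unique.Propositional using (Unique)
import Data.List.Relation.Unary.Unique.Propositional.Properties as Unique
open import Data.Nat.Base as ℕ using (ℕ; zero; suc; _<_; _≤_; _∸_; z≤n; s≤s)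
open import Data.Nat.Divisibility using (∣-refl; ∣m+n∣m⇒∣n; ∣m∣n⇒∣m+n; _∣?_)
import Data.Nat.Properties as ℕ
open import Data.Product.Base using (_×_; _,_; proj₁; proj₂)
open import Data.Sum.Base using (inj₁; inj₂)
open import Data.Unit.Base using () renaming (⊤ to Unit; tt to unit)
open import Data.Vec.Base as Vec using (Vec; []; _∷_; lookup)
open import Data.Vec.Relation.Unary.Linked as Linked using (Linked; linked?; [-]; _∷_)
open import Function.Base using (_∘_; id)
open import Relation.Binary.Construct.Closure.ReflexiveTransitive using (ε; _◅_)
open import Relation.Binary.Definitions using (Decidable)
open import Relation.Binary.PropositionalEquality using (_≡_; _≗_; refl; sym; trans; cong; cong₂; subst; isEquivalence;
  module ≡-Reasoning)
open import Relation.Binary.Structures using (IsEquivalence)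
open import Relation.Nullary.Decidable using (Dec; yes; no; does; ¬?; _×-dec_; _→-dec_; dec-true; dec-false;
  decidable-stable; from-no)
open import Relation.Nullary.Negation using (¬_; contradiction)
open import Algebra.Properties.CommutativeMonoid.Sum *-1-commutativeMonoid using ()
  renaming (sum-cong-≗ to ∏-cong; ∑-distrib-+ to ∏-distrib-*; sum-permute to ∏-permute)

open ≡-Reasoning

private
  variable
    A B C : Set
    k m n : ℕ

-- Sums and indicators

∑-cong : (xs : List A) {f g : A → ℤ} → (∀ x → f x ≡ g x) → ∑ xs f ≡ ∑ xs g
∑-cong []       f≗g = refl
∑-cong (x ∷ xs) f≗g = cong₂ _+_ (f≗g x) (∑-cong xs f≗g)

∑-++ : (xs ys : List A) (f : A → ℤ) → ∑ (xs ++ ys) f ≡ ∑ xs f + ∑ ys f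
∑-++ []       ys f = sym (+-identityˡ _)
∑-++ (x ∷ xs) ys f = trans (cong (λ s → f x + s) (∑-++ xs ys f)) (sym (+-assoc (f x) _ _))

∑-map : (h : A → B) (xs : List A) (f : B → ℤ) → ∑ (map h xs) f ≡ ∑ xs (f ∘ h)
∑-map h []       f = refl
∑-map h (x ∷ xs) f = cong (λ s → f (h x) + s) (∑-map h xs f)

∑-cartesianProductWith : (h : A → B → C) (xs : List A) (ys : List B) (f : C → ℤ) →
  ∑ (cartesianProductWith h xs ys) f ≡ ∑ xs λ x → ∑ ys λ y → f (h x y)
∑-cartesianProductWith h []       ys f = refl
∑-cartesianProductWith h (x ∷ xs) ys f = trans (∑-++ (map (h x) ys) _ f)
  (cong₂ _+_ (∑-map (h x) ys f) (∑-cartesianProductWith h xs ys f))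

∑-*ˡ : (c : ℤ) (xs : List A) (f : A → ℤ) → c * ∑ xs f ≡ ∑ xs λ x → c * f x
∑-*ˡ c []       f = *-zeroʳ c
∑-*ˡ c (x ∷ xs) f = trans (*-distribˡ-+ c (f x) _) (cong (λ s → c * f x + s) (∑-*ˡ c xs f))

∑-*ʳ : (c : ℤ) (xs : List A) (f : A → ℤ) → ∑ xs f * c ≡ ∑ xs λ x → f x * c
∑-*ʳ c xs f = trans (ℤ.*-comm _ c) (trans (∑-*ˡ c xs f) (∑-cong xs λ x → ℤ.*-comm c (f x)))

∑-+ : (xs : List A) (f g : A → ℤ) → ∑ xs f + ∑ xs g ≡ ∑ xs λ x → f x + g x
∑-+ []       f g = refl
∑-+ (x ∷ xs) f g = trans (interchange (f x) (∑ xs f) (g x) (∑ xs g))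
  (cong (λ s → f x + g x + s) (∑-+ xs f g))
  where
  interchange : ∀ p q r s → (p + q) + (r + s) ≡ (p + r) + (q + s)
  interchange = solve-∀

∑-0 : (xs : List A) → ∑ xs (λ _ → 0ℤ) ≡ 0ℤ
∑-0 []       = refl
∑-0 (x ∷ xs) = trans (+-identityˡ _) (∑-0 xs)

∑-comm : (xs : List A) (ys : List B) (f : A → B → ℤ) →
  ∑ xs (λ x → ∑ ys λ y → f x y) ≡ ∑ ys λ y → ∑ xs λ x → f x y
∑-comm []       ys f = sym (∑-0 ys)
∑-comm (x ∷ xs) ys f = trans (cong (λ s → ∑ ys (f x) + s) (∑-comm xs ys f)) (∑-+ ys (f x) λ y → ∑ xs λ x → f x y)

∑-product : (xs : List A) (ys : List B) (f : A → ℤ) (g : B → ℤ) →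
  ∑ xs f * ∑ ys g ≡ ∑ xs λ x → ∑ ys λ y → f x * g y
∑-product xs ys f g = trans (∑-*ʳ _ xs f) (∑-cong xs λ x → ∑-*ˡ (f x) ys g)

𝟙 : {P : Set} → Dec P → ℤ
𝟙 P? = if does P? then 1ℤ else 0ℤ

module _ {P Q : Set} where

  𝟙-cong : (P? : Dec P) (Q? : Dec Q) → (P → Q) → (Q → P) → 𝟙 P? ≡ 𝟙 Q?
  𝟙-cong (yes p) Q? f g = sym (cong (if_then 1ℤ else 0ℤ) (dec-true Q? (f p)))
  𝟙-cong (no ¬p) Q? f g = sym (cong (if_then 1ℤ else 0ℤ) (dec-false Q? (¬p ∘ g)))

  𝟙-× : (P? : Dec P) (Q? : Dec Q) → 𝟙 (P? ×-dec Q?) ≡ 𝟙 P? * 𝟙 Q?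
  𝟙-× (yes _) Q? = sym (*-identityˡ _)
  𝟙-× (no _)  Q? = refl

  -- Turns the recursive clause of `EvenRun` into the shape `1 - x` that `∏∈-1-expand` multiplies
  -- out.
  𝟙-¬× : (P? : Dec P) (Q? : Dec Q) → 𝟙 (¬? (P? ×-dec Q?)) ≡ 1ℤ - 𝟙 P? * 𝟙 Q?
  𝟙-¬× (yes _) (yes _) = refl
  𝟙-¬× (yes _) (no _)  = refl
  𝟙-¬× (no _)  Q?      = refl

module _ {P : A → Set} (P? : ∀ x → Dec (P x)) where

  ∑-filter : (xs : List A) (f : A → ℤ) → ∑ (filter P? xs) f ≡ ∑ xs λ x → 𝟙 (P? x) * f x
  ∑-filter []       f = refl
  ∑-filter (x ∷ xs) f with P? x
  ... | yes _ = cong₂ _+_ (sym (*-identityˡ (f x))) (∑-filter xs f)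
  ... | no _  = trans (∑-filter xs f) (sym (+-identityˡ _))

  length-filter : (xs : List A) → + length (filter P? xs) ≡ ∑ xs (𝟙 ∘ P?)
  length-filter []       = refl
  length-filter (x ∷ xs) with P? x
  ... | yes _ = cong (λ s → 1ℤ + s) (length-filter xs)
  ... | no _  = trans (length-filter xs) (sym (+-identityˡ _))

-- Powers and products

^-distribʳ-* : ∀ x y n → (x * y) ^ n ≡ x ^ n * y ^ n
^-distribʳ-* x y zero    = refl
^-distribʳ-* x y (suc n) = trans (cong (λ p → x * y * p) (^-distribʳ-* x y n)) (interchange x y (x ^ n) (y ^ n))
  where
  interchange : ∀ p q r s → (p * q) * (r * s) ≡ (p * r) * (q * s)
  interchange = solve-∀

∏-^ : (t : Fin k → ℤ) (n : ℕ) → ∏ t ^ n ≡ ∏ λ i → t i ^ n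
∏-^ {zero}  t n = ^-zeroˡ n
∏-^ {suc k} t n = trans (^-distribʳ-* (t zero) (∏ (t ∘ suc)) n) (cong (λ p → t zero ^ n * p) (∏-^ (t ∘ suc) n))

∏-const : ∀ k (x : ℤ) → ∏ {k} (λ _ → x) ≡ x ^ k
∏-const zero    x = refl
∏-const (suc k) x = cong (x *_) (∏-const k x)

pos-^ : ∀ t n → + (t ℕ.^ n) ≡ (+ t) ^ n
pos-^ t zero    = refl
pos-^ t (suc n) = trans (pos-* t (t ℕ.^ n)) (cong (λ p → + t * p) (pos-^ t n))

-1^n-involutive : ∀ n → -1ℤ ^ n * -1ℤ ^ n ≡ 1ℤ
-1^n-involutive n = trans (sym (^-distribʳ-* -1ℤ -1ℤ n)) (^-zeroˡ n)

-- Products over subsets and inclusion-exclusion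

∏∈ : Subset m → (Fin m → ℤ) → ℤ
∏∈ []            h = 1ℤ
∏∈ (inside ∷ S)  h = h zero * ∏∈ S (h ∘ suc)
∏∈ (outside ∷ S) h = ∏∈ S (h ∘ suc)

∏∈-cong : (S : Subset m) {g h : Fin m → ℤ} → (∀ e → g e ≡ h e) → ∏∈ S g ≡ ∏∈ S h
∏∈-cong []            g≗h = refl
∏∈-cong (inside ∷ S)  g≗h = cong₂ _*_ (g≗h zero) (∏∈-cong S (g≗h ∘ suc))
∏∈-cong (outside ∷ S) g≗h = ∏∈-cong S (g≗h ∘ suc)

∏∈-1 : (S : Subset m) → ∏∈ S (λ _ → 1ℤ) ≡ 1ℤ
∏∈-1 []            = refl
∏∈-1 (inside ∷ S)  = trans (*-identityˡ _) (∏∈-1 S)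
∏∈-1 (outside ∷ S) = ∏∈-1 S

∏∈-* : (S : Subset m) (g h : Fin m → ℤ) → ∏∈ S (λ e → g e * h e) ≡ ∏∈ S g * ∏∈ S h
∏∈-* []            g h = refl
∏∈-* (inside ∷ S)  g h = trans (cong (λ p → g zero * h zero * p) (∏∈-* S (g ∘ suc) (h ∘ suc)))
  (interchange (g zero) (h zero) (∏∈ S (g ∘ suc)) (∏∈ S (h ∘ suc)))
  where
  interchange : ∀ p q r s → (p * q) * (r * s) ≡ (p * r) * (q * s)
  interchange = solve-∀
∏∈-* (outside ∷ S) g h = ∏∈-* S (g ∘ suc) (h ∘ suc)

-- `Q` is any proposition equivalent to the universal statement over `S`, so that existing decision
-- procedures such as `coupled?` can be plugged in directly.
∏∈-𝟙 : (S : Subset m) {P : Fin m → Set} (P? : ∀ e → Dec (P e)) {Q : Set} (Q? : Dec Q) →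
  (Q → ∀ e → e ∈ S → P e) → ((∀ e → e ∈ S → P e) → Q) → ∏∈ S (𝟙 ∘ P?) ≡ 𝟙 Q?
∏∈-𝟙 []            P? Q? f g = 𝟙-cong (yes unit) Q? (λ _ → g λ _ ()) _
∏∈-𝟙 (outside ∷ S) P? Q? f g = ∏∈-𝟙 S (P? ∘ suc) Q? (λ q e e∈S → f q (suc e) (Vec.there e∈S))
  λ h → g λ { (suc e) (Vec.there e∈S) → h e e∈S }
∏∈-𝟙 (inside ∷ S)  P? Q? f g with P? zero
... | yes p = trans (*-identityˡ _) (∏∈-𝟙 S (P? ∘ suc) Q? (λ q e e∈S → f q (suc e) (Vec.there e∈S))
  λ h → g λ { zero _ → p ; (suc e) (Vec.there e∈S) → h e e∈S })
... | no ¬p = trans (*-zeroˡ (∏∈ S (𝟙 ∘ P? ∘ suc))) (𝟙-cong (no ¬p) Q? (λ p → contradiction p ¬p) (λ q → f q zero Vec.here))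

∑-subsets : (f : Subset (suc m) → ℤ) →
  ∑ (subsets (suc m)) f ≡ ∑ (subsets m) (λ S → f (outside ∷ S)) + ∑ (subsets m) (λ S → f (inside ∷ S))
∑-subsets {m} f = trans (∑-cartesianProductWith _∷_ (outside ∷ inside ∷ []) (subsets m) f)
  (cong (λ s → ∑ (subsets m) (λ S → f (outside ∷ S)) + s) (+-identityʳ _))

-- Induction on the ground set, splitting the sum by whether its first element lies in `T`. If that
-- element lies in `S`, the factor `1 - x zero` contributes 1 to the half without it and `- x zero`
-- to the half with it; otherwise only the first half survives.
∏∈-1-expand : (S : Subset m) (x : Fin m → ℤ) →
  ∏∈ S (λ e → 1ℤ - x e) ≡ ∑ (subsets m) λ T → 𝟙 (T ⊆? S) * (-1ℤ ^ ∣ T ∣ * ∏∈ T x)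
∏∈-1-expand []            x = refl
∏∈-1-expand {suc m} (s ∷ S) x = trans (expand s)
  (sym (∑-subsets λ T → 𝟙 (T ⊆? (s ∷ S)) * (-1ℤ ^ ∣ T ∣ * ∏∈ T x)))
  where
  E : ℤ
  E = ∑ (subsets m) λ T → 𝟙 (T ⊆? S) * (-1ℤ ^ ∣ T ∣ * ∏∈ T (x ∘ suc))
  without : ∀ s → E ≡ ∑ (subsets m) λ T → 𝟙 ((outside ∷ T) ⊆? (s ∷ S)) * (-1ℤ ^ ∣ T ∣ * ∏∈ T (x ∘ suc))
  without s = ∑-cong (subsets m) λ T → cong (_* (-1ℤ ^ ∣ T ∣ * ∏∈ T (x ∘ suc)))
    (𝟙-cong (T ⊆? S) ((outside ∷ T) ⊆? (s ∷ S)) out⊆ drop-∷-⊆)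
  pull : ∀ y i p q → - y * (i * (p * q)) ≡ i * (-1ℤ * p * (y * q))
  pull = solve-∀
  factor : ∀ y e → (1ℤ - y) * e ≡ e + - y * e
  factor = solve-∀
  expand : ∀ s → ∏∈ (s ∷ S) (λ e → 1ℤ - x e) ≡
    ∑ (subsets m) (λ T → 𝟙 ((outside ∷ T) ⊆? (s ∷ S)) * (-1ℤ ^ ∣ T ∣ * ∏∈ T (x ∘ suc))) +
    ∑ (subsets m) (λ T → 𝟙 ((inside ∷ T) ⊆? (s ∷ S)) * (-1ℤ * -1ℤ ^ ∣ T ∣ * (x zero * ∏∈ T (x ∘ suc))))
  expand outside = begin
    ∏∈ S (λ e → 1ℤ - x (suc e))  ≡⟨ ∏∈-1-expand S (x ∘ suc) ⟩
    E                             ≡⟨ +-identityʳ E ⟨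
    -- `(inside ∷ T) ⊆? (outside ∷ S)` computes to a refutation, so the second half is
    -- definitionally a sum of zeros.
    E + 0ℤ                        ≡⟨ cong₂ _+_ (without outside) (sym (∑-0 (subsets m))) ⟩
    _                             ∎
  expand inside = begin
    (1ℤ - x zero) * ∏∈ S (λ e → 1ℤ - x (suc e))  ≡⟨ cong ((1ℤ - x zero) *_) (∏∈-1-expand S (x ∘ suc)) ⟩
    (1ℤ - x zero) * E                             ≡⟨ factor (x zero) E ⟩
    E + - x zero * E                              ≡⟨ cong₂ _+_ (without inside) (trans (∑-*ˡ (- x zero) (subsets m) _)
      (∑-cong (subsets m) λ T → trans
        (cong (λ i → - x zero * (i * (-1ℤ ^ ∣ T ∣ * ∏∈ T (x ∘ suc))))
          (𝟙-cong (T ⊆? S) ((inside ∷ T) ⊆? (inside ∷ S)) s⊆s drop-∷-⊆))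
        (pull (x zero) (𝟙 ((inside ∷ T) ⊆? (inside ∷ S))) (-1ℤ ^ ∣ T ∣) (∏∈ T (x ∘ suc))))) ⟩
    _                                             ∎

-- Weighted sums over chains

-- Sum of ∏ᵢ aᵢ(Aᵢ) over all L ⊆ A₁ ⊆ … ⊆ Aₖ ⊆ S.
chain∑ : (Fin k → Subset m → ℤ) → Subset m → Subset m → ℤ
chain∑ {zero}      a L S = 𝟙 (L ⊆? S)
chain∑ {suc k} {m} a L S = ∑ (subsets m) λ T → 𝟙 (L ⊆? T) * (a zero T * chain∑ (a ∘ suc) T S)

-- The same for L ⊆ Aₖ ⊆ … ⊆ A₁ ⊆ S.
cochain∑ : (Fin k → Subset m → ℤ) → Subset m → Subset m → ℤ
cochain∑ {zero}      a L S = 𝟙 (L ⊆? S)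
cochain∑ {suc k} {m} a L S = ∑ (subsets m) λ T → 𝟙 (T ⊆? S) * (a zero T * cochain∑ (a ∘ suc) L T)

cochain∑-cong : {a b : Fin k → Subset m → ℤ} → (∀ i T → a i T ≡ b i T) →
  ∀ L S → cochain∑ a L S ≡ cochain∑ b L S
cochain∑-cong {zero}  a≗b L S = refl
cochain∑-cong {suc k} a≗b L S = ∑-cong (subsets _) λ T → cong (𝟙 (T ⊆? S) *_)
  (cong₂ _*_ (a≗b zero T) (cochain∑-cong (a≗b ∘ suc) L T))

-- `chain∑` recurses from the smallest set and `cochain∑` from the largest. Interchanging the sums
-- over the smallest and the largest set exposes the other end of the chain.
chain∑-last : (a : Fin (suc k) → Subset m → ℤ) (L S : Subset m) →
  chain∑ a L S ≡ ∑ (subsets m) λ T → 𝟙 (T ⊆? S) * (a (fromℕ k) T * chain∑ (a ∘ inject₁) L T)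
chain∑-last {zero}      a L S = ∑-cong (subsets _) λ T → swap (𝟙 (L ⊆? T)) (a zero T) (𝟙 (T ⊆? S))
  where
  swap : ∀ p q r → p * (q * r) ≡ r * (q * p)
  swap = solve-∀
chain∑-last {suc k} {m} a L S = begin
  ∑ Ω (λ T → l T * (a zero T * chain∑ (a ∘ suc) T S))
    ≡⟨ ∑-cong Ω (λ T → cong (λ s → l T * (a zero T * s)) (chain∑-last (a ∘ suc) T S)) ⟩
  ∑ Ω (λ T → l T * (a zero T * ∑ Ω λ U → r U * (z U * v T U)))
    ≡⟨ ∑-cong Ω (λ T → push (l T) (a zero T) (λ U → r U * (z U * v T U))) ⟩
  ∑ Ω (λ T → ∑ Ω λ U → l T * (a zero T * (r U * (z U * v T U))))
    ≡⟨ ∑-comm Ω Ω (λ T U → l T * (a zero T * (r U * (z U * v T U)))) ⟩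
  ∑ Ω (λ U → ∑ Ω λ T → l T * (a zero T * (r U * (z U * v T U))))
    ≡⟨ ∑-cong Ω (λ U → trans (∑-cong Ω λ T → shuffle (l T) (a zero T) (r U) (z U) (v T U))
         (sym (push (r U) (z U) (λ T → l T * (a zero T * v T U))))) ⟩
  ∑ Ω (λ U → r U * (z U * ∑ Ω λ T → l T * (a zero T * v T U))) ∎
  where
  Ω = subsets m
  l r z : Subset m → ℤ
  l T = 𝟙 (L ⊆? T)
  r U = 𝟙 (U ⊆? S)
  z U = a (fromℕ (suc k)) U
  v : Subset m → Subset m → ℤ
  v T U = chain∑ (λ i → a (suc (inject₁ i))) T U
  push : ∀ x y (f : Subset m → ℤ) → x * (y * ∑ Ω f) ≡ ∑ Ω λ U → x * (y * f U)
  push x y f = trans (cong (x *_) (∑-*ˡ y Ω f)) (∑-*ˡ x Ω _)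
  shuffle : ∀ p q r s t → p * (q * (r * (s * t))) ≡ r * (s * (p * (q * t)))
  shuffle = solve-∀

-- `opposite` sends `zero` to `fromℕ k` and `suc i` to `inject₁ (opposite i)`, which are exactly the
-- indices that `chain∑-last` produces.
chain∑≡cochain∑ : (a : Fin k → Subset m → ℤ) (L S : Subset m) → chain∑ a L S ≡ cochain∑ (a ∘ opposite) L S
chain∑≡cochain∑ {zero}  a L S = refl
chain∑≡cochain∑ {suc k} a L S = trans (chain∑-last a L S)
  (∑-cong (subsets _) λ T → cong (λ s → 𝟙 (T ⊆? S) * (a (fromℕ k) T * s)) (chain∑≡cochain∑ (a ∘ inject₁) L T))

-- The extra set `L` in front gives the first entry a predecessor to be compared with, so the
-- recursion of `Linked` matches that of `chain∑`. The upper bound `⊤` is automatic.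
∑-linked : (a : Fin k → Subset m → ℤ) (L : Subset m) →
  ∑ (tuples k (subsets m)) (λ As → 𝟙 (linked? _⊆?_ (L ∷ As)) * ∏ λ i → a i (lookup As i)) ≡ chain∑ a L ⊤
∑-linked {zero}      a L = 𝟙-cong (yes unit) (L ⊆? ⊤) (λ _ → ⊆⊤) _
∑-linked {suc k} {m} a L = trans
  (∑-cartesianProductWith _∷_ (subsets m) Ω λ As → 𝟙 (linked? _⊆?_ (L ∷ As)) * ∏ λ i → a i (lookup As i))
  (∑-cong (subsets m) λ T → begin
    ∑ Ω (λ As → 𝟙 ((L ⊆? T) ×-dec linked? _⊆?_ (T ∷ As)) * (a zero T * p As))
      ≡⟨ ∑-cong Ω (λ As → trans (cong (_* (a zero T * p As)) (𝟙-× (L ⊆? T) (linked? _⊆?_ (T ∷ As))))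
           (shuffle (𝟙 (L ⊆? T)) (𝟙 (linked? _⊆?_ (T ∷ As))) (a zero T) (p As))) ⟩
    ∑ Ω (λ As → 𝟙 (L ⊆? T) * (a zero T * (𝟙 (linked? _⊆?_ (T ∷ As)) * p As)))
      ≡⟨ trans (cong (𝟙 (L ⊆? T) *_) (∑-*ˡ (a zero T) Ω _)) (∑-*ˡ (𝟙 (L ⊆? T)) Ω _) ⟨
    𝟙 (L ⊆? T) * (a zero T * ∑ Ω λ As → 𝟙 (linked? _⊆?_ (T ∷ As)) * p As)
      ≡⟨ cong (λ s → 𝟙 (L ⊆? T) * (a zero T * s)) (∑-linked (a ∘ suc) T) ⟩
    𝟙 (L ⊆? T) * (a zero T * chain∑ (a ∘ suc) T ⊤) ∎)
  where
  Ω = tuples k (subsets m)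
  p : Vec (Subset m) k → ℤ
  p As = ∏ λ i → a (suc i) (lookup As i)
  shuffle : ∀ p q r s → p * q * (r * s) ≡ p * (r * (q * s))
  shuffle = solve-∀

∑-chains : (a : Fin k → Subset m → ℤ) →
  ∑ (chains k m) (λ As → ∏ λ i → a i (lookup As i)) ≡ chain∑ a ⊥ ⊤
∑-chains {k} {m} a = begin
  ∑ (chains k m) p                                        ≡⟨ ∑-filter (linked? _⊆?_) Ω p ⟩
  ∑ Ω (λ As → 𝟙 (linked? _⊆?_ As) * p As)                 ≡⟨ ∑-cong Ω (λ As → cong (_* p As)
    (𝟙-cong (linked? _⊆?_ As) (linked? _⊆?_ (⊥ ∷ As)) prepend Linked.tail)) ⟩
  ∑ Ω (λ As → 𝟙 (linked? _⊆?_ (⊥ ∷ As)) * p As)           ≡⟨ ∑-linked a ⊥ ⟩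
  chain∑ a ⊥ ⊤                                            ∎
  where
  Ω = tuples k (subsets m)
  p : Vec (Subset m) k → ℤ
  p As = ∏ λ i → a i (lookup As i)
  prepend : ∀ {k} {As : Vec (Subset m) k} → Linked _⊆_ As → Linked _⊆_ (⊥ ∷ As)
  prepend {As = []}     _  = [-]
  prepend {As = T ∷ Ts} ls = ⊥⊆ ∷ ls

-- Colorings constant on the classes of an equivalence relation

-- Equality is itself an equivalence relation, so `independent≤cover` yields both inequalities.
length-≡ : {xs ys : List A} → Unique xs → Unique ys →
  (∀ {x} → x ∈ₗ xs → x ∈ₗ ys) → (∀ {y} → y ∈ₗ ys → y ∈ₗ xs) → length xs ≡ length ys
length-≡ {xs = xs} {ys} xs! ys! xs⊆ys ys⊆xs = ℕ.≤-antisym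
  (independent≤cover isEquivalence xs ys xs! (All.tabulate xs⊆ys))
  (independent≤cover isEquivalence ys xs ys! (All.tabulate ys⊆xs))

-- Stands in for function extensionality: colorings are compared through their codes.
funToFin-cong : {f g : Fin m → Fin n} → f ≗ g → funToFin f ≡ funToFin g
funToFin-cong {zero}  f≗g = refl
funToFin-cong {suc m} f≗g = cong₂ combine (f≗g zero) (funToFin-cong (f≗g ∘ suc))

allPairs-lookup-injective : {R : A → A → Set} → (∀ {x y} → R x y → R y x) →
  {xs : List A} → AllPairs (λ x y → ¬ R x y) xs →
  ∀ i j → R (List.lookup xs i) (List.lookup xs j) → i ≡ j
allPairs-lookup-injective R-sym (x# ∷ xs#) zero    zero    r = refl
allPairs-lookup-injective R-sym (x# ∷ xs#) zero    (suc j) r = contradiction r (All.lookup x# (∈-lookup j))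
allPairs-lookup-injective R-sym (x# ∷ xs#) (suc i) zero    r = contradiction (R-sym r) (All.lookup x# (∈-lookup i))
allPairs-lookup-injective R-sym (x# ∷ xs#) (suc i) (suc j) r = cong suc (allPairs-lookup-injective R-sym xs# i j r)

module _ {R : Fin n → Fin n → Set} (R-equiv : IsEquivalence R) (R? : Decidable R) (t : ℕ) where

  private
    module R = IsEquivalence R-equiv

    representatives : List (Fin n)
    representatives = reps R-equiv R?

    class : Fin n → Fin (numClasses R?)
    class v = Any.index (proj₂ (reps-transversal R-equiv R?) v)

    representative : Fin (numClasses R?) → Fin n
    representative = List.lookup representatives

    R-representative : ∀ v → R v (representative (class v))
    R-representative v = lookup-index (proj₂ (reps-transversal R-equiv R?) v)

    representative-injective : ∀ i j → R (representative i) (representative j) → i ≡ j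
    representative-injective = allPairs-lookup-injective R.sym (proj₁ (reps-transversal R-equiv R?))

    class-cong : ∀ {u v} → R u v → class u ≡ class v
    class-cong {u} {v} r = representative-injective _ _
      (R.trans (R.sym (R-representative u)) (R.trans r (R-representative v)))

    class-representative : ∀ i → class (representative i) ≡ i
    class-representative i = representative-injective _ _ (R.sym (R-representative (representative i)))

    -- Codes instead of functions, so that propositional equality is the right notion when counting.
    -- `extend` pulls a coloring of the classes back along `class`.
    extend : Fin (t ℕ.^ numClasses R?) → Fin (t ℕ.^ n)
    extend g = funToFin (finToFun {t} g ∘ class)

    restrict : Fin (t ℕ.^ n) → Fin (t ℕ.^ numClasses R?)
    restrict f = funToFin (finToFun {t} f ∘ representative)

    restrict-extend : ∀ g → restrict (extend g) ≡ g
    restrict-extend g = trans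
      (funToFin-cong λ i → trans (finToFun-funToFin _ (representative i)) (cong (finToFun g) (class-representative i)))
      (funToFin-finToFin {numClasses R?} {t} g)

    extend-restrict : ∀ f → (∀ u v → R u v → finToFun {t} f u ≡ finToFun f v) → extend (restrict f) ≡ f
    extend-restrict f resp = trans
      (funToFin-cong λ v → trans (finToFun-funToFin _ (class v)) (sym (resp v _ (R-representative v))))
      (funToFin-finToFin {n} {t} f)

  -- `extend` is injective, with left inverse `restrict`, and its image consists of the codes of the
  -- colorings that are constant on classes. Hence these are as numerous as the colorings of the
  -- classes.
  count-respecting : {P : (Fin n → Fin t) → Set} (P? : ∀ f → Dec (P f)) →
    (∀ f → P f → ∀ u v → R u v → f u ≡ f v) →
    (∀ f → (∀ u v → R u v → f u ≡ f v) → P f) →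
    ∑ (map finToFun (allFin (t ℕ.^ n))) (𝟙 ∘ P?) ≡ (+ t) ^ numClasses R?
  count-respecting P? P⇒ ⇒P = begin
    ∑ (map finToFun (allFin _)) (𝟙 ∘ P?)           ≡⟨ ∑-map finToFun (allFin _) (𝟙 ∘ P?) ⟩
    ∑ (allFin _) (𝟙 ∘ P? ∘ finToFun)               ≡⟨ length-filter (P? ∘ finToFun) (allFin _) ⟨
    + length (filter (P? ∘ finToFun) (allFin _))   ≡⟨ cong +_ (length-≡ filter! map! filter⊆map map⊆filter) ⟩
    + length (map extend (allFin _))               ≡⟨ cong +_ (trans (length-map extend (allFin _)) (length-tabulate id)) ⟩
    + (t ℕ.^ numClasses R?)                        ≡⟨ pos-^ t (numClasses R?) ⟩
    (+ t) ^ numClasses R?                          ∎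
    where
    filter! = Unique.filter⁺ (P? ∘ finToFun) (Unique.allFin⁺ (t ℕ.^ n))
    map! : Unique (map extend (allFin _))
    map! = Unique.map⁺
      (λ {g} {h} eq → trans (sym (restrict-extend g)) (trans (cong restrict eq) (restrict-extend h)))
      (Unique.allFin⁺ _)
    filter⊆map : ∀ {f} → f ∈ₗ filter (P? ∘ finToFun) (allFin _) → f ∈ₗ map extend (allFin _)
    filter⊆map {f} f∈ = subst (_∈ₗ _)
      (extend-restrict f (P⇒ _ (proj₂ (∈-filter⁻ (P? ∘ finToFun) {xs = allFin _} f∈))))
      (∈-map⁺ extend (∈-allFin (restrict f)))
    map⊆filter : ∀ {f} → f ∈ₗ map extend (allFin _) → f ∈ₗ filter (P? ∘ finToFun) (allFin _)
    map⊆filter {f} f∈ with ∈-map⁻ extend f∈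
    ... | g , _ , refl = ∈-filter⁺ (P? ∘ finToFun) (∈-allFin f) (⇒P _ λ u v r →
      trans (finToFun-funToFin (finToFun {t} g ∘ class) u)
        (trans (cong (finToFun g) (class-cong r)) (sym (finToFun-funToFin (finToFun {t} g ∘ class) v))))

-- Coupled multicolorings

-- The number of leading colors on which a and b agree before they first differ is even.
EvenRun : {V : Set} {C : Fin k → Set} → (∀ i → V → C i) → V → V → Set
EvenRun {zero}  f a b = Unit
EvenRun {suc k} f a b = ¬ (f zero a ≡ f zero b × EvenRun (λ i → f (suc i)) a b)

evenRun? : {V : Set} {t : Fin k → ℕ} (f : ∀ i → V → Fin (t i)) → ∀ a b → Dec (EvenRun f a b)
evenRun? {zero}  f a b = yes unit
evenRun? {suc k} f a b = ¬? ((f zero a Fin.≟ f zero b) ×-dec evenRun? (λ i → f (suc i)) a b)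

-- Needed because `ends` lists each edge in one orientation while `Adjacent` admits both.
evenRun-sym : {V : Set} {C : Fin k → Set} (f : ∀ i → V → C i) → ∀ {a b} → EvenRun f a b → EvenRun f b a
evenRun-sym {zero}  f _  = unit
evenRun-sym {suc k} f ¬r (eq , r) = ¬r (sym eq , evenRun-sym (λ i → f (suc i)) r)

even-2+⁺ : Even n → Even (2 ℕ.+ n)
even-2+⁺ = ∣m∣n⇒∣m+n ∣-refl

even-2+⁻ : Even (2 ℕ.+ n) → Even n
even-2+⁻ e = ∣m+n∣m⇒∣n e ∣-refl

odd-1 : Odd 1
odd-1 = from-no (2 ∣? 1)

module _ (G : Graph) where

  open Graph G

  -- The clause for `k > 1` taken at every `k`, so that an induction in steps of two can end at 0 or
  -- 1.
  CoupledAt : {C : Fin k → Set} → Multicoloring G C → Vertex → Vertex → Set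
  CoupledAt f a b = CoupledEven G f a b × CoupledLast G f a b

  module _ {C : Fin (suc (suc k)) → Set} (f : Multicoloring G C) (a b : Vertex) where

    private
      f″ : Multicoloring G (λ i → C (suc (suc i)))
      f″ i = f (suc (suc i))

    -- Position 1 is the given equality, position 2 is even and imposes nothing, and later positions
    -- drop by two with unchanged parity. The bound `suc j` thus becomes `j ∸ 1`, where truncation
    -- at `j = 0` leaves an empty range.
    agreeOdd⁺ : ∀ {j} → f zero a ≡ f zero b → AgreeOdd G f″ a b (j ∸ 1) → AgreeOdd G f a b (suc j)
    agreeOdd⁺ eq ag zero          _   _         = eq
    agreeOdd⁺ eq ag (suc zero)    odd _         = contradiction ∣-refl odd
    agreeOdd⁺ eq ag (suc (suc i)) odd (s≤s i≤j) = ag i (odd ∘ even-2+⁺) (ℕ.∸-monoˡ-≤ 1 i≤j)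

    agreeOdd⁻ : ∀ {j} → AgreeOdd G f a b (suc j) → f zero a ≡ f zero b × AgreeOdd G f″ a b (j ∸ 1)
    agreeOdd⁻ {j} ag = ag zero odd-1 (s≤s z≤n) , λ i odd i≤j → ag (suc (suc i)) (odd ∘ even-2+⁻) (s≤s (lift j i≤j))
      where
      lift : ∀ {i} j → suc i ≤ j ∸ 1 → suc (suc i) ≤ j
      lift (suc j) i≤j = s≤s i≤j

    -- With `coupledAt-step⁺`, this makes coupling a recursion in steps of two: once the first
    -- colors agree, the second must agree and the remaining colors must again be coupled.
    coupledAt-step⁻ : CoupledAt f a b → f zero a ≡ f zero b → f 1F a ≡ f 1F b × CoupledAt f″ a b
    coupledAt-step⁻ (even , last) eq =
      -- Here the bound is 1, so no odd position beyond the first is involved.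
      even 1F ∣-refl (agreeOdd⁺ eq λ { _ _ () }) ,
      (λ i e ag → even (suc (suc i)) (even-2+⁺ e) (agreeOdd⁺ eq ag)) ,
      λ odd i i≡k ag → last (odd ∘ even-2+⁻) (suc (suc i)) (cong (2 ℕ.+_) i≡k) (agree i i≡k ag)
      where
      -- `agreeOdd⁺` expects a bound of the form `suc j`. Generalizing `k` to `k′` allows matching
      -- on `index i ≡ k′`, which supplies it.
      agree : ∀ {k′} (i : Fin k) → index i ≡ k′ → AgreeOdd G f″ a b (k′ ∸ 2) → AgreeOdd G f a b k′
      agree i refl ag = agreeOdd⁺ eq ag

    coupledAt-step⁺ : (f zero a ≡ f zero b → f 1F a ≡ f 1F b × CoupledAt f″ a b) → CoupledAt f a b
    coupledAt-step⁺ h = even , last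
      where
      even : CoupledEven G f a b
      even zero          e _  = contradiction e odd-1
      even (suc zero)    _ ag = proj₁ (h (ag zero odd-1 ℕ.≤-refl))
      even (suc (suc i)) e ag = let eq , ag″ = agreeOdd⁻ ag in
        proj₁ (proj₂ (h eq)) i (even-2+⁻ e) ag″
      last : CoupledLast G f a b
      -- If position 2 is last, the number of colors is 2, which is not odd.
      last odd (suc zero)    refl _ _ = odd ∣-refl
      last odd (suc (suc i)) i≡k ag =
        let i≡k″ = ℕ.suc-injective (ℕ.suc-injective i≡k) ; eq , ag″ = agree i i≡k″ ag in
        proj₂ (proj₂ (h eq)) (odd ∘ even-2+⁺) i i≡k″ ag″
        where
        agree : ∀ {k′} (i : Fin k) → index i ≡ k′ → AgreeOdd G f a b k′ →
          f zero a ≡ f zero b × AgreeOdd G f″ a b (k′ ∸ 2)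
        agree i refl = agreeOdd⁻

  module _ {t : Fin (suc (suc k)) → ℕ} (f : Multicoloring G (λ i → Fin (t i))) (a b : Vertex) where

    -- Two steps of `EvenRun` nest two negations; decidable equality of colors removes the double
    -- negation.
    evenRun-step⁻ : EvenRun f a b → f zero a ≡ f zero b → f 1F a ≡ f 1F b × EvenRun (λ i → f (suc (suc i))) a b
    evenRun-step⁻ ¬r eq = decidable-stable
      ((f 1F a Fin.≟ f 1F b) ×-dec evenRun? (λ i → f (suc (suc i))) a b) λ ¬r′ → ¬r (eq , ¬r′)

  coupledAt⇒evenRun : {t : Fin k → ℕ} (f : Multicoloring G (λ i → Fin (t i))) → ∀ a b → CoupledAt f a b → EvenRun f a b
  coupledAt⇒evenRun {0} f a b _ = unit
  -- The bound `1 ∸ 2` is 0, so the agreement hypothesis is vacuous and the colors must differ.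
  coupledAt⇒evenRun {1} f a b (_ , last) (eq , _) = last odd-1 zero refl (λ { _ _ () }) eq
  coupledAt⇒evenRun {suc (suc k)} f a b c (eq , ¬r) =
    let eq′ , c″ = coupledAt-step⁻ f a b c eq in ¬r (eq′ , coupledAt⇒evenRun (λ i → f (suc (suc i))) a b c″)

  evenRun⇒coupledAt : {t : Fin k → ℕ} (f : Multicoloring G (λ i → Fin (t i))) → ∀ a b → EvenRun f a b → CoupledAt f a b
  evenRun⇒coupledAt {0} f a b _ = (λ ()) , λ _ ()
  evenRun⇒coupledAt {1} f a b ¬r = (λ { zero e _ → contradiction e odd-1 }) , λ { _ zero _ _ eq → ¬r (eq , unit) }
  evenRun⇒coupledAt {suc (suc k)} f a b ¬r = coupledAt-step⁺ f a b λ eq →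
    let eq′ , r = evenRun-step⁻ f a b ¬r eq in eq′ , evenRun⇒coupledAt (λ i → f (suc (suc i))) a b r

  coupled⇒evenRun : {t : Fin k → ℕ} (f : Multicoloring G (λ i → Fin (t i))) → Coupled G f →
    ∀ a b → Adjacent G ⊤ a b → EvenRun f a b
  coupled⇒evenRun {0} f c a b adj = unit
  coupled⇒evenRun {1} f c a b adj (eq , _) = c a b adj eq
  coupled⇒evenRun {suc (suc k)} f c a b adj = coupledAt⇒evenRun f a b (c a b adj)

  evenRun⇒coupled : {t : Fin k → ℕ} (f : Multicoloring G (λ i → Fin (t i))) →
    (∀ a b → Adjacent G ⊤ a b → EvenRun f a b) → Coupled G f
  evenRun⇒coupled {0} f r a b adj = evenRun⇒coupledAt f a b (r a b adj)
  evenRun⇒coupled {1} f r a b adj eq = r a b adj (eq , unit)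
  evenRun⇒coupled {suc (suc k)} f r a b adj = evenRun⇒coupledAt f a b (r a b adj)

  -- Counting coupled multicolorings by chains of edge sets

  evenRunOn? : {t : Fin k → ℕ} (f : Multicoloring G (λ i → Fin (t i))) (e : Edge) →
    Dec (EvenRun f (proj₁ (ends e)) (proj₂ (ends e)))
  evenRunOn? f e = evenRun? f (proj₁ (ends e)) (proj₂ (ends e))

  -- Coupling is a separate condition on each edge, and by symmetry the listed orientation suffices.
  𝟙-coupled : {t : Fin k → ℕ} (f : Multicoloring G (λ i → Fin (t i))) →
    𝟙 (coupled? G f) ≡ ∏∈ ⊤ (λ e → 𝟙 (evenRunOn? f e))
  𝟙-coupled f = sym (∏∈-𝟙 ⊤ (evenRunOn? f) (coupled? G f)
    (λ c e _ → coupled⇒evenRun f c _ _ (e , ∈⊤ , inj₁ refl))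
    (λ r → evenRun⇒coupled f λ where
      a b (e , e∈ , inj₁ eq) → subst (λ (u , v) → EvenRun f u v) eq (r e e∈)
      a b (e , e∈ , inj₂ eq) → evenRun-sym f (subst (λ (u , v) → EvenRun f u v) eq (r e e∈))))

  monochromatic? : {t : ℕ} (f : Vertex → Fin t) (e : Edge) → Dec (f (proj₁ (ends e)) ≡ f (proj₂ (ends e)))
  monochromatic? f e = f (proj₁ (ends e)) Fin.≟ f (proj₂ (ends e))

  -- The same list as the first factor in `multicolorings`, so the sum over multicolorings splits
  -- definitionally along the product.
  vertexColorings : (t : ℕ) → List (Vertex → Fin t)
  vertexColorings t = map finToFun (allFin (t ℕ.^ order))

  ∑-monochromatic : (t : ℕ) (S : Subset size) →
    ∑ (vertexColorings t) (λ f → ∏∈ S λ e → 𝟙 (monochromatic? f e)) ≡ (+ t) ^ components G S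
  ∑-monochromatic t S = trans
    (∑-cong (vertexColorings t) λ f → ∏∈-𝟙 S (monochromatic? f) (mono? f) id id)
    (count-respecting (connected-isEquivalence G S) (connected? G S) t mono?
      (λ f mono u v → respects f mono)
      (λ f resp e e∈S → resp _ _ ((e , e∈S , inj₁ refl) ◅ ε)))
    where
    Mono : (Vertex → Fin t) → Set
    Mono f = ∀ e → e ∈ S → f (proj₁ (ends e)) ≡ f (proj₂ (ends e))
    mono? : ∀ f → Dec (Mono f)
    mono? f = Fin.all? λ e → (e ∈? S) →-dec monochromatic? f e
    respects : ∀ f → Mono f → ∀ {u v} → Connected G S u v → f u ≡ f v
    respects f mono ε = refl
    respects f mono ((e , e∈S , inj₁ eq) ◅ c) = trans (subst (λ (u , v) → f u ≡ f v) eq (mono e e∈S)) (respects f mono c)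
    respects f mono ((e , e∈S , inj₂ eq) ◅ c) = trans (sym (subst (λ (u , v) → f u ≡ f v) eq (mono e e∈S))) (respects f mono c)

  -- A factor of the `χᴹ` summand multiplied by `t ^ components G ⊤`, with exponents still in terms
  -- of components.
  weight : ℕ → Subset size → ℤ
  weight t S = -1ℤ ^ ∣ S ∣ * (+ t) ^ components G S

  -- Stated for every `S` because the induction hypothesis is applied to the sets `T` that the
  -- expansion produces. For a fixed `T` the summand is a function of the first coloring times a
  -- function of the others, so the two sums separate.
  ∑-evenRun : (t : Fin k → ℕ) (S : Subset size) →
    ∑ (multicolorings G t) (λ f → ∏∈ S λ e → 𝟙 (evenRunOn? f e)) ≡ cochain∑ (weight ∘ t) ⊥ S
  ∑-evenRun {zero}  t S = trans (+-identityʳ _) (trans (∏∈-1 S) (𝟙-cong (yes unit) (⊥ ⊆? S) (λ _ → ⊥⊆) _))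
  ∑-evenRun {suc k} t S = begin
    ∑ (multicolorings G t) (λ f → ∏∈ S λ e → 𝟙 (evenRunOn? f e))
      ≡⟨ ∑-cartesianProductWith _ F Fs (λ f → ∏∈ S λ e → 𝟙 (evenRunOn? f e)) ⟩
    ∑ F (λ f → ∑ Fs λ g → ∏∈ S λ e → 𝟙 (¬? (monochromatic? f e ×-dec evenRunOn? g e)))
      ≡⟨ ∑-cong F (λ f → ∑-cong Fs λ g → expand f g) ⟩
    ∑ F (λ f → ∑ Fs λ g → ∑ Ω λ T → i T * (s T * (p T f * q T g)))
      ≡⟨ ∑-cong F (λ f → ∑-comm Fs Ω λ g T → i T * (s T * (p T f * q T g))) ⟩
    ∑ F (λ f → ∑ Ω λ T → ∑ Fs λ g → i T * (s T * (p T f * q T g)))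
      ≡⟨ ∑-comm F Ω (λ f T → ∑ Fs λ g → i T * (s T * (p T f * q T g))) ⟩
    ∑ Ω (λ T → ∑ F λ f → ∑ Fs λ g → i T * (s T * (p T f * q T g)))
      ≡⟨ ∑-cong Ω collect ⟩
    cochain∑ (weight ∘ t) ⊥ S ∎
    where
    F = vertexColorings (t zero)
    Fs = multicolorings G (t ∘ suc)
    Ω = subsets size
    i s : Subset size → ℤ
    i T = 𝟙 (T ⊆? S)
    s T = -1ℤ ^ ∣ T ∣
    p : Subset size → (Vertex → Fin (t zero)) → ℤ
    p T f = ∏∈ T λ e → 𝟙 (monochromatic? f e)
    q : Subset size → Multicoloring G (λ i → Fin (t (suc i))) → ℤ
    q T g = ∏∈ T λ e → 𝟙 (evenRunOn? g e)
    expand : ∀ f g → ∏∈ S (λ e → 𝟙 (¬? (monochromatic? f e ×-dec evenRunOn? g e))) ≡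
      ∑ Ω λ T → i T * (s T * (p T f * q T g))
    expand f g = trans (∏∈-cong S λ e → 𝟙-¬× (monochromatic? f e) (evenRunOn? g e))
      (trans (∏∈-1-expand S λ e → 𝟙 (monochromatic? f e) * 𝟙 (evenRunOn? g e))
        (∑-cong Ω λ T → cong (λ x → i T * (s T * x))
          (∏∈-* T (λ e → 𝟙 (monochromatic? f e)) (λ e → 𝟙 (evenRunOn? g e)))))
    pull : ∀ i s p q → i * (s * (p * q)) ≡ (i * s * p) * q
    pull = solve-∀
    push : ∀ i s p q → (i * s * p) * q ≡ i * (s * p * q)
    push = solve-∀
    collect : ∀ T → ∑ F (λ f → ∑ Fs λ g → i T * (s T * (p T f * q T g))) ≡
      i T * (weight (t zero) T * cochain∑ (weight ∘ t ∘ suc) ⊥ T)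
    collect T = begin
      ∑ F (λ f → ∑ Fs λ g → i T * (s T * (p T f * q T g)))
        ≡⟨ ∑-cong F (λ f → ∑-cong Fs λ g → pull (i T) (s T) (p T f) (q T g)) ⟩
      ∑ F (λ f → ∑ Fs λ g → i T * s T * p T f * q T g)
        ≡⟨ ∑-product F Fs (λ f → i T * s T * p T f) (q T) ⟨
      ∑ F (λ f → i T * s T * p T f) * ∑ Fs (q T)
        ≡⟨ cong₂ _*_ (sym (∑-*ˡ (i T * s T) F (p T))) (∑-evenRun (t ∘ suc) T) ⟩
      i T * s T * ∑ F (p T) * cochain∑ (weight ∘ t ∘ suc) ⊥ T
        ≡⟨ cong (λ x → i T * s T * x * cochain∑ (weight ∘ t ∘ suc) ⊥ T) (∑-monochromatic (t zero) T) ⟩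
      i T * s T * (+ t zero) ^ components G T * cochain∑ (weight ∘ t ∘ suc) ⊥ T
        ≡⟨ push (i T) (s T) ((+ t zero) ^ components G T) (cochain∑ (weight ∘ t ∘ suc) ⊥ T) ⟩
      i T * (weight (t zero) T * cochain∑ (weight ∘ t ∘ suc) ⊥ T) ∎

  χᴳ-chains : (t : Fin k → ℕ) →
    + χᴳ G t ≡ ∑ (chains k size) λ As → ∏ λ i → weight (t (opposite i)) (lookup As i)
  χᴳ-chains {k} t = begin
    + χᴳ G t                                                  ≡⟨ length-filter (coupled? G) (multicolorings G t) ⟩
    ∑ (multicolorings G t) (λ f → 𝟙 (coupled? G f))           ≡⟨ ∑-cong (multicolorings G t) 𝟙-coupled ⟩
    ∑ (multicolorings G t) (λ f → ∏∈ ⊤ λ e → 𝟙 (evenRunOn? f e)) ≡⟨ ∑-evenRun t ⊤ ⟩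
    cochain∑ (weight ∘ t) ⊥ ⊤
      -- A double reversal is inserted so that `chain∑≡cochain∑` absorbs one `opposite` and leaves
      -- the other on `t`.
      ≡⟨ cochain∑-cong (λ i T → cong (λ j → weight (t j) T) (sym (opposite-involutive i))) ⊥ ⊤ ⟩
    cochain∑ (weight ∘ t ∘ opposite ∘ opposite) ⊥ ⊤           ≡⟨ chain∑≡cochain∑ (weight ∘ t ∘ opposite) ⊥ ⊤ ⟨
    chain∑ (weight ∘ t ∘ opposite) ⊥ ⊤                        ≡⟨ ∑-chains (weight ∘ t ∘ opposite) ⟨
    ∑ (chains k size) (λ As → ∏ λ i → weight (t (opposite i)) (lookup As i)) ∎

  -- From component counts to ranks

  corank+components : (S : Subset size) → components G ⊤ ℕ.+ (rank G ⊤ ∸ rank G S) ≡ components G S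
  -- After adding `rank G S`, both sides equal the number of vertices; monotonicity of rank makes
  -- the truncated subtraction exact.
  corank+components S = ℕ.+-cancelʳ-≡ (rank G S) _ _ (begin
    components G ⊤ ℕ.+ (rank G ⊤ ∸ rank G S) ℕ.+ rank G S    ≡⟨ ℕ.+-assoc (components G ⊤) _ _ ⟩
    components G ⊤ ℕ.+ (rank G ⊤ ∸ rank G S ℕ.+ rank G S)    ≡⟨ cong (components G ⊤ ℕ.+_) (ℕ.m∸n+n≡m (rank-mono G (⊆⊤ {p = S}))) ⟩
    components G ⊤ ℕ.+ rank G ⊤                              ≡⟨ ℕ.+-comm (components G ⊤) _ ⟩
    rank G ⊤ ℕ.+ components G ⊤                              ≡⟨ trans (rank+components G ⊤) (sym (rank+components G S)) ⟩
    rank G S ℕ.+ components G S                              ≡⟨ ℕ.+-comm (rank G S) _ ⟩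
    components G S ℕ.+ rank G S                              ∎)

  χᴳ≡χᴹ : (t : Fin k → ℕ) →
    + χᴳ G t ≡ ∏ (λ i → + t i) ^ components G ⊤ * χᴹ (graphicMatroid G) (λ i → + t (opposite i))
  χᴳ≡χᴹ {k} t = trans (χᴳ-chains t) (sym (trans
    (∑-*ˡ (∏ (λ i → + t i) ^ c) (chains k size) _)
    (∑-cong (chains k size) λ As → begin
      ∏ (λ i → + t i) ^ c * ∏ (λ i → a As i * (+ t (opposite i)) ^ r As i)
        -- The product of all `t i` is invariant under reversal, which aligns it with the reversed
        -- arguments of `χᴹ` factor by factor.
        ≡⟨ cong (λ x → x ^ c * ∏ (λ i → a As i * (+ t (opposite i)) ^ r As i)) (∏-permute (λ i → + t i) reverse) ⟩
      ∏ (λ i → + t (opposite i)) ^ c * ∏ (λ i → a As i * (+ t (opposite i)) ^ r As i)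
        ≡⟨ cong (_* ∏ (λ i → a As i * (+ t (opposite i)) ^ r As i)) (∏-^ (λ i → + t (opposite i)) c) ⟩
      ∏ (λ i → (+ t (opposite i)) ^ c) * ∏ (λ i → a As i * (+ t (opposite i)) ^ r As i)
        ≡⟨ ∏-distrib-* (λ i → (+ t (opposite i)) ^ c) (λ i → a As i * (+ t (opposite i)) ^ r As i) ⟨
      ∏ (λ i → (+ t (opposite i)) ^ c * (a As i * (+ t (opposite i)) ^ r As i))
        ≡⟨ ∏-cong (λ i → absorb (+ t (opposite i)) (lookup As i)) ⟩
      ∏ (λ i → weight (t (opposite i)) (lookup As i)) ∎)))
    where
    c = components G ⊤
    a : Vec (Subset size) k → Fin k → ℤ
    a As i = -1ℤ ^ ∣ lookup As i ∣
    r : Vec (Subset size) k → Fin k → ℕ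
    r As i = rank G ⊤ ∸ rank G (lookup As i)
    swap : ∀ p q r → p * (q * r) ≡ q * (p * r)
    swap = solve-∀
    absorb : ∀ x S → x ^ c * (-1ℤ ^ ∣ S ∣ * x ^ (rank G ⊤ ∸ rank G S)) ≡ -1ℤ ^ ∣ S ∣ * x ^ components G S
    absorb x S = trans (swap (x ^ c) (-1ℤ ^ ∣ S ∣) _)
      (cong (-1ℤ ^ ∣ S ∣ *_) (trans (sym (^-distribˡ-+-* x c _)) (cong (x ^_) (corank+components S))))

-- Specializing the Tutte polynomial of an arbitrary matroid

module _ (M : Matroid) where

  open Matroid M

  -- Write `d` for the corank of `S`. The sign splits into `-1ℤ ^ d` and `-1ℤ ^ rk S`; the former
  -- cancels against the sign of `(- t) ^ d`, and the latter joins the nullity sign to give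
  -- `-1ℤ ^ ∣ S ∣`.
  χᴹ-term : ∀ t S → -1ℤ ^ rk ⊤ * ((1ℤ - t - 1ℤ) ^ (rk ⊤ ∸ rk S) * (0ℤ - 1ℤ) ^ (∣ S ∣ ∸ rk S)) ≡
    -1ℤ ^ ∣ S ∣ * t ^ (rk ⊤ ∸ rk S)
  χᴹ-term t S = begin
    -1ℤ ^ rk ⊤ * ((1ℤ - t - 1ℤ) ^ d * -1ℤ ^ (∣ S ∣ ∸ rk S))
      ≡⟨ cong₂ (λ x y → x * (y * -1ℤ ^ (∣ S ∣ ∸ rk S)))
           (trans (cong (-1ℤ ^_) (sym (ℕ.m∸n+n≡m (rk-mono (⊆⊤ {p = S}))))) (^-distribˡ-+-* -1ℤ d (rk S)))
           (trans (cong (_^ d) (neg t)) (^-distribʳ-* -1ℤ t d)) ⟩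
    -1ℤ ^ d * -1ℤ ^ rk S * (-1ℤ ^ d * t ^ d * -1ℤ ^ (∣ S ∣ ∸ rk S))
      ≡⟨ regroup (-1ℤ ^ d) (-1ℤ ^ rk S) (t ^ d) (-1ℤ ^ (∣ S ∣ ∸ rk S)) ⟩
    (-1ℤ ^ d * -1ℤ ^ d) * (-1ℤ ^ rk S * -1ℤ ^ (∣ S ∣ ∸ rk S)) * t ^ d
      ≡⟨ cong₂ (λ x y → x * y * t ^ d) (-1^n-involutive d)
           (trans (sym (^-distribˡ-+-* -1ℤ (rk S) _)) (cong (-1ℤ ^_) (ℕ.m+[n∸m]≡n (rk-≤ S)))) ⟩
    1ℤ * -1ℤ ^ ∣ S ∣ * t ^ d
      ≡⟨ cong (_* t ^ d) (*-identityˡ (-1ℤ ^ ∣ S ∣)) ⟩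
    -1ℤ ^ ∣ S ∣ * t ^ d ∎
    where
    d = rk ⊤ ∸ rk S
    neg : ∀ t → 1ℤ - t - 1ℤ ≡ -1ℤ * t
    neg = solve-∀
    regroup : ∀ p q r s → p * q * (p * r * s) ≡ (p * p) * (q * s) * r
    regroup = solve-∀

  -- The global sign is a product of `k` copies of `-1ℤ ^ rk ⊤`, one for each set of the chain, so
  -- the comparison reduces to single factors.
  χᴹ≡Tᴹ : (t : Fin k → ℤ) →
    χᴹ M t ≡ -1ℤ ^ (k ℕ.* rk ⊤) * Tᴹ M (λ i → 1ℤ - t i) (λ _ → 0ℤ)
  χᴹ≡Tᴹ {k} t = sym (trans (∑-*ˡ (-1ℤ ^ (k ℕ.* rk ⊤)) (chains k size) _)
    (∑-cong (chains k size) λ As → trans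
      (cong (_* ∏ (term As)) (trans (cong (-1ℤ ^_) (ℕ.*-comm k (rk ⊤)))
        (trans (sym (^-*-assoc -1ℤ (rk ⊤) k)) (sym (∏-const k (-1ℤ ^ rk ⊤))))))
      (trans (sym (∏-distrib-* (λ _ → -1ℤ ^ rk ⊤) (term As)))
        (∏-cong λ i → χᴹ-term (t i) (lookup As i)))))
    where
    term : Vec (Subset size) k → Fin k → ℤ
    term As i = (1ℤ - t i - 1ℤ) ^ (rk ⊤ ∸ rk (lookup As i)) * (0ℤ - 1ℤ) ^ (∣ lookup As i ∣ ∸ rk (lookup As i))

-- Both evaluations for the graphic matroid

theorem1p10 : (G : Graph) (k : ℕ) → 0 < k → (t : Fin k → ℕ) → (∀ i → 0 < t i) →
    (+ χᴳ G t ≡ (∏ (λ i → + t i)) ^ components G ⊤ * χᴹ (graphicMatroid G) (λ i → + t (opposite i)))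
    × (+ χᴳ G t ≡ -1ℤ ^ (k ℕ.* rank G ⊤) * (∏ (λ i → + t i)) ^ components G ⊤
    * Tᴹ (graphicMatroid G) (λ i → 1ℤ - + t (opposite i)) (λ i → 0ℤ))
theorem1p10 G k _ t _ = χᴳ≡χᴹ G t , (begin
  + χᴳ G t
    ≡⟨ χᴳ≡χᴹ G t ⟩
  p * χᴹ M (λ i → + t (opposite i))
    ≡⟨ cong (p *_) (χᴹ≡Tᴹ M (λ i → + t (opposite i))) ⟩
  p * (s * Tᴹ M x (λ _ → 0ℤ))
    ≡⟨ swap p s (Tᴹ M x (λ _ → 0ℤ)) ⟩
  s * p * Tᴹ M x (λ _ → 0ℤ) ∎)
  where
  M = graphicMatroid G
  p s : ℤ
  p = ∏ (λ i → + t i) ^ components G ⊤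
  s = -1ℤ ^ (k ℕ.* rank G ⊤)
  x : Fin k → ℤ
  x i = 1ℤ - + t (opposite i)
  swap : ∀ p s x → p * (s * x) ≡ s * p * x
  swap = solve-∀
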